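{- Let $G$ be a $C_3$-free cactus graph. Then $\Gamma_{pr}(G)=2\Gamma(G)$ if and only if $G$ is isomorphic to $m_1K_2+m_2C_5$ for some nonnegative integers $m_1,m_2$ with $m_1+m_2\geq 1$.
   Context: All graphs are finite, simple and undirected. A set $D\subseteq V(G)$ is dominating if every vertex is in $D$ or adjacent to a vertex of $D$; it is minimal if no proper subset is dominating. $\Gamma(G)$ is the maximum cardinality of a minimal dominating set of $G$. A paired dominating set (PDS) is a dominating set $D$ such that $G[D]$ has a perfect matching; a PDS is minimal if no proper subset is a PDS. $\Gamma_{pr}(G)$ is the maximum cardinality of a minimal PDS. A cactus graph is a graph in which every edge lies on at most one cycle (the paper defines cactus graphs as connected, but here the statement is applied to graphs whose components are such). $C_3$-free means no triangle. $m_1K_2+m_2C_5$ denotes the disjoint union of $m_1$ copies of $K_2$ and $m_2$ copies of the 5-cycle $C_5$. -}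

module Defs where

open import Data.Nat using (ℕ; zero; suc; _+_; _*_; _≤_)
open import Data.Nat.DivMod using (_mod_; _%_)
open import Data.Fin using (Fin; toℕ; splitAt; remQuot)
open import Data.Fin.Subset using (Subset; _∈_; _⊂_; ∣_∣)
open import Data.Bool using (Bool; true; false; _∧_; _∨_; not)
open import Data.Product using (Σ; _×_; _,_)
open import Data.Sum using (_⊎_; inj₁; inj₂)
open import Data.Empty using (⊥)
open import Relation.Nullary using (¬_)
open import Relation.Nullary.Decidable using (⌊_⌋)
open import Relation.Binary.PropositionalEquality using (_≡_)
open import Function.Bundles using (_↔_; Inverse)
open import Function.Definitions using (Injective)
import Data.Nat as ℕ
import Data.Fin as F

record Graph (n : ℕ) : Set where
  field
    adj    : Fin n → Fin n → Bool
    sym    : ∀ u v → adj u v ≡ adj v u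
    irrefl : ∀ v → adj v v ≡ false

IsMaxCard : ∀ {n} → (Subset n → Set) → ℕ → Set
IsMaxCard {n} P k =
  (Σ (Subset n) λ D → P D × ∣ D ∣ ≡ k) × (∀ D → P D → ∣ D ∣ ≤ k)

next : ∀ {k} → Fin (suc (suc (suc k))) → Fin (suc (suc (suc k)))
next {k} i = suc (toℕ i) mod (suc (suc (suc k)))

module _ {n : ℕ} (G : Graph n) where
  open Graph G

  E : Fin n → Fin n → Set
  E u v = adj u v ≡ true

  Dominating : Subset n → Set
  Dominating D = ∀ v → v ∈ D ⊎ Σ (Fin n) λ u → u ∈ D × E u v

  MinimalDominating : Subset n → Set
  MinimalDominating D = Dominating D × (∀ D′ → D′ ⊂ D → ¬ Dominating D′)

  HasPerfectMatching : Subset n → Set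
  HasPerfectMatching D = Σ (Fin n → Fin n) λ m →
    ∀ v → v ∈ D → (m v ∈ D) × E v (m v) × (m (m v) ≡ v)

  PairedDominating : Subset n → Set
  PairedDominating D = Dominating D × HasPerfectMatching D

  MinimalPairedDominating : Subset n → Set
  MinimalPairedDominating D =
    PairedDominating D × (∀ D′ → D′ ⊂ D → ¬ PairedDominating D′)

  UpperDomination : ℕ → Set
  UpperDomination = IsMaxCard MinimalDominating

  UpperPairedDomination : ℕ → Set
  UpperPairedDomination = IsMaxCard MinimalPairedDominating

  record Cycle : Set where
    field
      len    : ℕ
      vert   : Fin (suc (suc (suc len))) → Fin n
      inj    : Injective _≡_ _≡_ vert
      edges  : ∀ i → E (vert i) (vert (next i))

  OnCycle : Cycle → Fin n → Fin n → Set
  OnCycle C x y = Σ (Fin (suc (suc (suc len)))) λ i →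
      (vert i ≡ x × vert (next i) ≡ y) ⊎ (vert i ≡ y × vert (next i) ≡ x)
    where open Cycle C

  -- every edge lies on at most one cycle (cycles compared as edge sets);
  -- components are cacti
  Cactus : Set
  Cactus = ∀ (C C′ : Cycle) x y → OnCycle C x y → OnCycle C′ x y →
    ∀ a b → (OnCycle C a b → OnCycle C′ a b) × (OnCycle C′ a b → OnCycle C a b)

  TriangleFree : Set
  TriangleFree = ∀ x y z → E x y → E y z → E x z → ⊥

  Isomorphic : ∀ {n′} → (Fin n′ → Fin n′ → Bool) → Set
  Isomorphic {n′} adj′ = Σ (Fin n ↔ Fin n′) λ f →
    ∀ u v → adj u v ≡ adj′ (Inverse.to f u) (Inverse.to f v)

-- adjacency of m₁K₂ + m₂C₅ on Fin (m₁ * 2 + m₂ * 5):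
-- first m₁*2 vertices are (copy, position∈Fin 2), rest (copy, position∈Fin 5)
K2C5adj : (m₁ m₂ : ℕ) → Fin (m₁ * 2 + m₂ * 5) → Fin (m₁ * 2 + m₂ * 5) → Bool
K2C5adj m₁ m₂ i j with splitAt (m₁ * 2) i | splitAt (m₁ * 2) j
... | inj₁ a | inj₁ b with remQuot {m₁} 2 a | remQuot {m₁} 2 b
...   | (c , p) | (d , q) = ⌊ c F.≟ d ⌋ ∧ not ⌊ p F.≟ q ⌋
K2C5adj m₁ m₂ i j | inj₂ a | inj₂ b with remQuot {m₂} 5 a | remQuot {m₂} 5 b
...   | (c , p) | (d , q) = ⌊ c F.≟ d ⌋ ∧
         (⌊ toℕ q ℕ.≟ suc (toℕ p) % 5 ⌋ ∨ ⌊ toℕ p ℕ.≟ suc (toℕ q) % 5 ⌋)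
K2C5adj m₁ m₂ i j | inj₁ _ | inj₂ _ = false
K2C5adj m₁ m₂ i j | inj₂ _ | inj₁ _ = false

{-# OPTIONS --safe #-}
module Submission where

-- Let D be a minimal paired dominating set with |D| = 2Γ(G), hence made of Γ(G) matched pairs; every
-- independent set has at most Γ(G) vertices. By minimality each pair has either an endpoint that is
-- a leaf of G[D] or an external private neighbour. In the latter case it spans three vertices, and
-- since a triangle-free cactus on q vertices has an independent set of more than q/3 vertices (it
-- always has a vertex of degree at most 2), such pairs would give too large an independent set. So
-- the pairs are {u i, v i} with u i a leaf. A vertex r outside D must then be adjacent to u i and u l
-- for some edge v i v l, which closes a 5-cycle, and since 5-cycles through the same u i v i coincide,
-- only an edge between two vertices outside D could join two of these cycles; such an edge allows
-- a minimal dominating set of size Γ(G) + 1. Hence all components are K₂ or C₅.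

open import Defs
open import Data.Bool using (Bool; true; false; not; _∧_; _∨_)
import Data.Bool.Properties as Bool
open import Data.Empty using (⊥; ⊥-elim)
open import Data.Fin using (Fin; zero; suc; toℕ; fromℕ; splitAt; join; remQuot; combine)
open import Data.Fin.Patterns using (0F; 1F; 2F; 3F; 4F)
import Data.Fin.Properties as Fin
open import Data.Fin.Subset using (Subset; ⊤; ∣_∣) renaming (_∈_ to _∈ₛ_; _⊂_ to _⊂ₛ_)
import Data.Fin.Subset.Properties as Subset
open import Data.List using (List; []; _∷_; [_]; _++_; length; map; filter; allFin; tabulate;
  upTo; lookup; concatMap; cartesianProduct)
open import Data.List.Membership.Propositional using (_∈_; find; lose)
open import Data.List.Membership.Propositional.Properties
open import Data.List.Properties using (length-++; length-map; length-tabulate; filter-notAll)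
open import Data.List.Relation.Unary.All as All using (All; []; _∷_)
import Data.List.Relation.Unary.All.Properties as All
open import Data.List.Relation.Unary.AllPairs as AllPairs using (AllPairs; []; _∷_)
import Data.List.Relation.Unary.AllPairs.Properties as AllPairs
open import Data.List.Relation.Unary.Any as Any using (Any; here; there)
import Data.List.Relation.Unary.Any.Properties as Any
open import Data.List.Relation.Unary.Unique.Propositional using (Unique)
import Data.List.Relation.Unary.Unique.Propositional.Properties as Unique
open import Data.Nat.DivMod using (_%_; m<n⇒m%n≡m; n%n≡0; m%n<n)
open import Data.Nat using (ℕ; zero; suc; _+_; _*_; _≤_; _<_; z≤n; s≤s)
import Data.Nat.Properties as ℕ
open import Data.Nat.Solver using (module +-*-Solver)
open import Data.Product using (Σ; ∃; ∃₂; _×_; _,_; proj₁; proj₂; uncurry)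
open import Data.Sum as Sum using (_⊎_; inj₁; inj₂; [_,_]′)
import Data.Vec as Vec
import Data.Vec.Properties as Vec
open import Function using (_∘_; id)
open import Function.Bundles using (_⇔_; mk⇔; mk↔ₛ′; Inverse)
open import Relation.Binary.Definitions using (tri<; tri≈; tri>)
open import Relation.Binary.PropositionalEquality hiding ([_])
open import Relation.Nullary using (¬_; Dec; yes; no; does)
open import Relation.Nullary.Decidable using (_×-dec_; _⊎-dec_; _→-dec_; ¬?; dec-true;
  decidable-stable; from-yes; from-no; ⌊_⌋)
open import Relation.Unary using (Decidable)

-- The bound q/3 must be beaten strictly. If p pairs have no leaf, their 3p vertices are not seen by
-- the leaves chosen in the other pairs, so an independent set of exactly p among them would only
-- reproduce Γ(G). Disjoint triangles attain q/3, which is where triangle-freeness enters. The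
-- 5-cycles are isolated by a second use of minimality: given an edge `v i v l`, drop `u i` and
-- `u l` and match `v i` with `v l`. This fails only because some vertex sees nothing of D but `u i`
-- and `u l`. That vertex is outside D and, by uniqueness, is the apex of the 5-cycle through the
-- edge; so an apex sees only two vertices of D. Nearly all upper bounds rest on independent sets,
-- which extend to minimal dominating ones. For an edge between two apexes this fails: two 5-cycles
-- joined by an edge have independence number 4, exactly their number of pairs. Hence the set of
-- size Γ(G) + 1 used there is not independent, and its minimality is shown by private neighbours.
-- For the converse both parameters are computed component by component: Γ is 1 on K₂ and 2 on C₅,
-- Γpr is 2 and 4.

-- Counting subsets by duplicate-free lists

unique-⊆⇒length≤ : ∀ {A : Set} {xs ys : List A} → Unique xs →
  (∀ {x} → x ∈ xs → x ∈ ys) → length xs ≤ length ys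
unique-⊆⇒length≤ {xs = []} _ _ = z≤n
unique-⊆⇒length≤ {xs = x ∷ xs} (x# ∷ u) sub with ∈-∃++ (sub (here refl))
... | as , bs , refl = ℕ.≤-trans (s≤s (unique-⊆⇒length≤ u sub′)) (ℕ.≤-reflexive len)
  where
  sub′ : ∀ {y} → y ∈ xs → y ∈ as ++ bs
  sub′ y∈ with ∈-++⁻ as (sub (there y∈))
  ... | inj₁ q            = ∈-++⁺ˡ q
  ... | inj₂ (here refl)  = ⊥-elim (All.lookup x# y∈ refl)
  ... | inj₂ (there q)    = ∈-++⁺ʳ as q
  len : suc (length (as ++ bs)) ≡ length (as ++ x ∷ bs)
  len rewrite length-++ as {bs} | length-++ as {x ∷ bs} = sym (ℕ.+-suc (length as) (length bs))

AllPairs-lookup : ∀ {A : Set} {R : A → A → Set} → (∀ {x y} → R x y → R y x) →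
  ∀ {xs x y} → AllPairs R xs → x ∈ xs → y ∈ xs → x ≡ y ⊎ R x y
AllPairs-lookup s (a ∷ as) (here refl) (here refl) = inj₁ refl
AllPairs-lookup s (a ∷ as) (here refl) (there y∈) = inj₂ (All.lookup a y∈)
AllPairs-lookup s (a ∷ as) (there x∈) (here refl) = inj₂ (s (All.lookup a x∈))
AllPairs-lookup s (a ∷ as) (there x∈) (there y∈) = AllPairs-lookup s as x∈ y∈

lookup-injective : ∀ {A : Set} {xs : List A} → Unique xs → ∀ {i j} → lookup xs i ≡ lookup xs j → i ≡ j
lookup-injective (a ∷ u) {zero} {zero} _ = refl
lookup-injective (a ∷ u) {zero} {suc j} eq = ⊥-elim (All.lookup a (∈-lookup j) eq)
lookup-injective (a ∷ u) {suc i} {zero} eq = ⊥-elim (All.lookup a (∈-lookup i) (sym eq))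
lookup-injective (a ∷ u) {suc i} {suc j} eq = cong suc (lookup-injective u eq)

elements : ∀ {n} → Subset n → List (Fin n)
elements Vec.[] = []
elements (true Vec.∷ p) = zero ∷ map suc (elements p)
elements (false Vec.∷ p) = map suc (elements p)

length-elements : ∀ {n} (p : Subset n) → length (elements p) ≡ ∣ p ∣
length-elements Vec.[] = refl
length-elements (true Vec.∷ p) = cong suc (trans (length-map suc (elements p)) (length-elements p))
length-elements (false Vec.∷ p) = trans (length-map suc (elements p)) (length-elements p)

∈-elements⁺ : ∀ {n} {p : Subset n} {x} → x ∈ₛ p → x ∈ elements p
∈-elements⁺ {p = true Vec.∷ p} Vec.here = here refl
∈-elements⁺ {p = true Vec.∷ p} (Vec.there x∈) = there (∈-map⁺ suc (∈-elements⁺ x∈))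
∈-elements⁺ {p = false Vec.∷ p} (Vec.there x∈) = ∈-map⁺ suc (∈-elements⁺ x∈)

∈-elements⁻ : ∀ {n} {p : Subset n} {x} → x ∈ elements p → x ∈ₛ p
∈-elements⁻ {p = true Vec.∷ p} (here refl) = Vec.here
∈-elements⁻ {p = true Vec.∷ p} (there x∈) with ∈-map⁻ suc x∈
... | _ , y∈ , refl = Vec.there (∈-elements⁻ y∈)
∈-elements⁻ {p = false Vec.∷ p} x∈ with ∈-map⁻ suc x∈
... | _ , y∈ , refl = Vec.there (∈-elements⁻ y∈)

elements-unique : ∀ {n} (p : Subset n) → Unique (elements p)
elements-unique Vec.[] = []
elements-unique (true Vec.∷ p) =
  All.map⁺ (All.universal (λ _ ()) _) ∷ Unique.map⁺ Fin.suc-injective (elements-unique p)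
elements-unique (false Vec.∷ p) = Unique.map⁺ Fin.suc-injective (elements-unique p)

length≤∣∣ : ∀ {n} {xs : List (Fin n)} {p} → Unique xs → (∀ {x} → x ∈ xs → x ∈ₛ p) → length xs ≤ ∣ p ∣
length≤∣∣ {p = p} u sub =
  ℕ.≤-trans (unique-⊆⇒length≤ u (∈-elements⁺ ∘ sub)) (ℕ.≤-reflexive (length-elements p))

∣∣≤length : ∀ {n} {xs : List (Fin n)} {p} → (∀ {x} → x ∈ₛ p → x ∈ xs) → ∣ p ∣ ≤ length xs
∣∣≤length {p = p} sub = ℕ.≤-trans (ℕ.≤-reflexive (sym (length-elements p)))
  (unique-⊆⇒length≤ (elements-unique p) (sub ∘ ∈-elements⁻))

module _ {n} {P : Fin n → Set} (P? : Decidable P) where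

  subset : Subset n
  subset = Vec.tabulate (does ∘ P?)

  ∈-subset⁺ : ∀ {x} → P x → x ∈ₛ subset
  ∈-subset⁺ {x} px = Vec.lookup⇒[]= x subset (trans (Vec.lookup∘tabulate _ x) (dec-true (P? x) px))

  ∈-subset⁻ : ∀ {x} → x ∈ₛ subset → P x
  ∈-subset⁻ {x} x∈ with P? x | trans (sym (Vec.lookup∘tabulate (does ∘ P?) x)) (Vec.[]=⇒lookup x∈)
  ... | yes px | _ = px

_∈?_ : ∀ {n} (x : Fin n) (xs : List (Fin n)) → Dec (x ∈ xs)
x ∈? xs = Any.any? (x Fin.≟_) xs

fromList : ∀ {n} → List (Fin n) → Subset n
fromList xs = subset (_∈? xs)

∣fromList∣ : ∀ {n} {xs : List (Fin n)} → Unique xs → ∣ fromList xs ∣ ≡ length xs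
∣fromList∣ {xs = xs} u = ℕ.≤-antisym (∣∣≤length (∈-subset⁻ (_∈? xs))) (length≤∣∣ u (∈-subset⁺ (_∈? xs)))

-- Private neighbours, and independent sets as minimal dominating sets

module Domination {n} (G : Graph n) where
  open Graph G renaming (sym to adj-sym)

  E? : ∀ u v → Dec (E G u v)
  E? u v = adj u v Bool.≟ true

  E-sym : ∀ {u v} → E G u v → E G v u
  E-sym {u} {v} e = trans (adj-sym v u) e

  E⇒≢ : ∀ {u v} → E G u v → u ≢ v
  E⇒≢ {u} e refl with trans (sym e) (irrefl u)
  ... | ()

  Apart : Fin n → Fin n → Set
  Apart x y = x ≢ y × ¬ E G x y

  Apart-sym : ∀ {x y} → Apart x y → Apart y x
  Apart-sym (ne , na) = ne ∘ sym , na ∘ E-sym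

  -- A proper subset misses some `x` of `D` and therefore leaves the private vertex `y` of `x`
  -- undominated.
  private-neighbours⇒minimal : ∀ {D} → Dominating G D →
    (∀ x → x ∈ₛ D → ∃ λ y → ∀ z → z ∈ₛ D → z ≡ y ⊎ E G y z → z ≡ x) → MinimalDominating G D
  private-neighbours⇒minimal {D} dom priv = dom , λ D′ (sub , x , x∈ , x∉) dom′ →
    let y , only = priv x x∈ in
    [ (λ y∈ → x∉ (subst (_∈ₛ D′) (only y (sub y∈) (inj₁ refl)) y∈))
    , (λ (z , z∈ , e) → x∉ (subst (_∈ₛ D′) (only z (sub z∈) (inj₂ (E-sym e))) z∈)) ]′ (dom′ y)

  -- Without such a `y`, deleting `x` from `D` would keep it dominating. Since `D` dominates `y`,
  -- and only `x` can do so, `y` is `x` or a neighbour of it.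
  minimal⇒private-neighbours : ∀ {D} → MinimalDominating G D →
    ∀ x → x ∈ₛ D → ∃ λ y → (y ≡ x ⊎ E G y x) × (∀ z → z ∈ₛ D → z ≡ y ⊎ E G y z → z ≡ x)
  minimal⇒private-neighbours {D} (dom , min) x x∈
    with Fin.any? (λ y → Fin.all? λ z → (z Subset.∈? D) →-dec (((z Fin.≟ y) ⊎-dec E? y z) →-dec (z Fin.≟ x)))
  ... | yes (y , only) = y , near , only
    where
    near : y ≡ x ⊎ E G y x
    near with dom y
    ... | inj₁ y∈ = inj₁ (only y y∈ (inj₁ refl))
    ... | inj₂ (u , u∈ , e) = inj₂ (subst (E G y) (only u u∈ (inj₂ (E-sym e))) (E-sym e))
  ... | no none = ⊥-elim (min (subset P?) sub dom′)
    where
    P? : Decidable λ z → z ∈ₛ D × z ≢ x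
    P? z = (z Subset.∈? D) ×-dec ¬? (z Fin.≟ x)
    sub : subset P? ⊂ₛ D
    sub = (λ z∈ → proj₁ (∈-subset⁻ P? z∈)) , x , x∈ , λ x∈′ → proj₂ (∈-subset⁻ P? x∈′) refl
    dom′ : Dominating G (subset P?)
    dom′ y with Fin.any? (λ z → (P? z) ×-dec ((z Fin.≟ y) ⊎-dec E? y z))
    ... | yes (z , pz , inj₁ refl) = inj₁ (∈-subset⁺ P? pz)
    ... | yes (z , pz , inj₂ e) = inj₂ (z , ∈-subset⁺ P? pz , E-sym e)
    ... | no no-z = ⊥-elim (none (y , λ z z∈ near → decidable-stable (z Fin.≟ x)
                      λ ne → no-z (z , (z∈ , ne) , near)))

  -- Greedy extension: a vertex of `xs` joins unless it equals or sees a vertex already chosen. With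
  -- all vertices in `xs` the result is a maximal independent set.
  extend-independent : ∀ (xs : List (Fin n)) {I} → AllPairs Apart I →
    ∃ λ J → AllPairs Apart J × length I ≤ length J × (∀ x → x ∈ xs → x ∈ J ⊎ ∃ λ u → u ∈ J × E G x u)
  extend-independent [] {I} ind = I , ind , ℕ.≤-refl , λ _ ()
  extend-independent (x ∷ xs) ind with extend-independent xs ind
  ... | J , indJ , le , dom with Any.any? (λ u → (x Fin.≟ u) ⊎-dec E? x u) J
  ... | yes any = J , indJ , le , dom′
    where
    dom′ : ∀ y → y ∈ x ∷ xs → y ∈ J ⊎ ∃ λ u → u ∈ J × E G y u
    dom′ y (there y∈) = dom y y∈
    dom′ y (here refl) with find any
    ... | u , u∈ , inj₁ refl = inj₁ u∈
    ... | u , u∈ , inj₂ e = inj₂ (u , u∈ , e)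
  ... | no none = x ∷ J , All.map (λ na → na ∘ inj₁ , na ∘ inj₂) (All.¬Any⇒All¬ J none) ∷ indJ
                , ℕ.m≤n⇒m≤1+n le , dom′
    where
    dom′ : ∀ y → y ∈ x ∷ xs → y ∈ x ∷ J ⊎ ∃ λ u → u ∈ x ∷ J × E G y u
    dom′ y (here refl) = inj₁ (here refl)
    dom′ y (there y∈) with dom y y∈
    ... | inj₁ q = inj₁ (there q)
    ... | inj₂ (u , u∈ , e) = inj₂ (u , there u∈ , e)

  -- In an independent set each vertex is its own private neighbour.
  independent-dominating⇒minimal : ∀ {J} → AllPairs Apart J →
    (∀ x → x ∈ J ⊎ ∃ λ u → u ∈ J × E G x u) → MinimalDominating G (fromList J)
  independent-dominating⇒minimal {J} ind dom = private-neighbours⇒minimal dom′ λ x x∈ → x , only x x∈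
    where
    dom′ : Dominating G (fromList J)
    dom′ x with dom x
    ... | inj₁ x∈ = inj₁ (∈-subset⁺ (_∈? J) x∈)
    ... | inj₂ (u , u∈ , e) = inj₂ (u , ∈-subset⁺ (_∈? J) u∈ , E-sym e)
    only : ∀ x → x ∈ₛ fromList J → ∀ z → z ∈ₛ fromList J → z ≡ x ⊎ E G x z → z ≡ x
    only x x∈ z z∈ (inj₁ eq) = eq
    only x x∈ z z∈ (inj₂ e)
      with AllPairs-lookup Apart-sym ind (∈-subset⁻ (_∈? J) z∈) (∈-subset⁻ (_∈? J) x∈)
    ... | inj₁ eq = eq
    ... | inj₂ (_ , na) = ⊥-elim (na (E-sym e))

  Apart⇒unique : ∀ {I} → AllPairs Apart I → Unique I
  Apart⇒unique = AllPairs.map proj₁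

  -- A maximal independent set containing `I` is a minimal dominating set, so the independence
  -- number is at most Γ.
  independent-bound : ∀ {k} → (∀ D → MinimalDominating G D → ∣ D ∣ ≤ k) →
    ∀ {I} → AllPairs Apart I → length I ≤ k
  independent-bound Γ≤k ind with extend-independent (allFin n) ind
  ... | J , indJ , le , dom = ℕ.≤-trans le (ℕ.≤-trans (ℕ.≤-reflexive (sym (∣fromList∣ (Apart⇒unique indJ))))
    (Γ≤k _ (independent-dominating⇒minimal indJ λ x → dom x (∈-allFin x))))

-- Large independent sets in triangle-free cacti

toℕ-next-< : ∀ {k} (i : Fin (3 + k)) → suc (toℕ i) < 3 + k → toℕ (next i) ≡ suc (toℕ i)
toℕ-next-< {k} i lt = trans (Fin.toℕ-fromℕ< (m%n<n (suc (toℕ i)) (3 + k))) (m<n⇒m%n≡m lt)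

toℕ-next-last : ∀ {k} (i : Fin (3 + k)) → toℕ i ≡ 2 + k → toℕ (next i) ≡ 0
toℕ-next-last {k} i eq = trans (Fin.toℕ-fromℕ< (m%n<n (suc (toℕ i)) (3 + k)))
  (trans (cong (λ z → suc z % (3 + k)) eq) (n%n≡0 (3 + k)))

module LowDegree {n} (G : Graph n) (cactus : Cactus G) (△-free : TriangleFree G) where
  open Domination G

  -- Only the indices up to `l` carry meaning; a total `at` lets the path be shifted when it grows,
  -- which happens at the end `at 0`.
  record Path (l : ℕ) : Set where
    field
      at   : ℕ → Fin n
      inj  : ∀ {a b} → a ≤ l → b ≤ l → at a ≡ at b → a ≡ b
      edge : ∀ {a} → a < l → E G (at a) (at (suc a))

  module _ {l} (p : Path l) where
    open Path p

    closePath : ∀ k → 2 + k ≤ l → E G (at (2 + k)) (at 0) → Cycle G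
    closePath k k≤l chord = record
      { len = k
      ; vert = at ∘ toℕ
      ; inj = λ {i} {j} eq → Fin.toℕ-injective (inj (below i) (below j) eq)
      ; edges = edges
      }
      where
      below : ∀ (i : Fin (3 + k)) → toℕ i ≤ l
      below i = ℕ.≤-trans (Fin.toℕ≤pred[n] i) k≤l
      edges : ∀ (i : Fin (3 + k)) → E G (at (toℕ i)) (at (toℕ (next i)))
      edges i with toℕ i ℕ.≟ 2 + k
      ... | yes eq = subst₂ (λ a b → E G (at a) (at b)) (sym eq) (sym (toℕ-next-last i eq)) chord
      ... | no ne = subst (λ b → E G (at (toℕ i)) (at b)) (sym (toℕ-next-< i (s≤s lt))) (edge (ℕ.≤-trans lt k≤l))
        where
        lt : toℕ i < 2 + k
        lt = ℕ.≤∧≢⇒< (Fin.toℕ≤pred[n] i) ne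

    -- The two cycles closed by chords at the initial vertex share the first edge of the path.
    chord-≤ : ∀ {a b} → 2 + a ≤ l → 2 + b ≤ l → E G (at (2 + a)) (at 0) → E G (at (2 + b)) (at 0) →
      2 + b ≤ 2 + a
    chord-≤ {a} {b} a≤l b≤l ea eb
      with proj₂ (cactus (closePath a a≤l ea) (closePath b b≤l eb) (at 0) (at 1)
                   (zero , inj₁ (refl , refl)) (zero , inj₁ (refl , refl)) (at (2 + b)) (at 0))
             (fromℕ (2 + b) , inj₁ (cong at (Fin.toℕ-fromℕ (2 + b))
                                      , cong at (toℕ-next-last (fromℕ (2 + b)) (Fin.toℕ-fromℕ (2 + b)))))
    ... | i , on = position on
      where
      bound : ∀ (i : Fin (3 + a)) → at (toℕ i) ≡ at (2 + b) → 2 + b ≤ 2 + a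
      bound i eq = subst (_≤ 2 + a) (inj (ℕ.≤-trans (Fin.toℕ≤pred[n] i) a≤l) b≤l eq) (Fin.toℕ≤pred[n] i)
      position : (at (toℕ i) ≡ at (2 + b) × at (toℕ (next i)) ≡ at 0) ⊎
                 (at (toℕ i) ≡ at 0 × at (toℕ (next i)) ≡ at (2 + b)) → 2 + b ≤ 2 + a
      position (inj₁ (eq , _)) = bound i eq
      position (inj₂ (_ , eq)) = bound (next i) eq

    path-extension : ∀ {y} → E G (at 0) y → (∀ {a} → a ≤ l → at a ≢ y) → Path (suc l)
    path-extension {y} e new = record { at = at′ ; inj = inj′ ; edge = edge′ }
      where
      at′ : ℕ → Fin n
      at′ zero = y
      at′ (suc a) = at a
      inj′ : ∀ {a b} → a ≤ suc l → b ≤ suc l → at′ a ≡ at′ b → a ≡ b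
      inj′ {zero} {zero} _ _ _ = refl
      inj′ {zero} {suc b} _ (s≤s b≤) eq = ⊥-elim (new b≤ (sym eq))
      inj′ {suc a} {zero} (s≤s a≤) _ eq = ⊥-elim (new a≤ eq)
      inj′ {suc a} {suc b} (s≤s a≤) (s≤s b≤) eq = cong suc (inj a≤ b≤ eq)
      edge′ : ∀ {a} → a < suc l → E G (at′ a) (at′ (suc a))
      edge′ {zero} _ = E-sym e
      edge′ {suc a} (s≤s a<) = edge a<

    path-length : l < n
    path-length = Fin.injective⇒≤ {f = λ (i : Fin (suc l)) → at (toℕ i)}
      λ {i} {j} eq → Fin.toℕ-injective (inj (Fin.toℕ≤pred[n] i) (Fin.toℕ≤pred[n] j) eq)

  Saturated : List (Fin n) → ∀ {l} → Path l → Set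
  Saturated Q {l} p = ∀ {y} → y ∈ Q → E G (at 0) y → ∃ λ a → a ≤ l × at a ≡ y
    where open Path p

  -- A path has fewer than `n` edges, so the length still missing serves as `fuel`: it cannot run
  -- out before the path is saturated.
  saturated-path : ∀ Q fuel {l} (p : Path l) → Path.at p 0 ∈ Q → n ≤ fuel + l →
    ∃ λ l′ → Σ (Path l′) λ p′ → Path.at p′ 0 ∈ Q × Saturated Q p′
  saturated-path Q zero p _ n≤l = ⊥-elim (ℕ.<⇒≱ (path-length p) n≤l)
  saturated-path Q (suc fuel) {l} p start n≤
    with Any.any? (λ y → E? (Path.at p 0) y ×-dec ¬? (y ∈? map (Path.at p) (upTo (suc l)))) Q
  ... | yes any with find any
  ...   | y , y∈ , e , y∉ =
    saturated-path Q fuel (path-extension p e λ { a≤ refl → y∉ (∈-map⁺ _ (∈-upTo⁺ (s≤s a≤))) }) y∈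
      (ℕ.≤-trans n≤ (ℕ.≤-reflexive (sym (ℕ.+-suc fuel l))))
  saturated-path Q (suc fuel) {l} p start n≤ | no none = l , p , start , sat
    where
    sat : Saturated Q p
    sat {y} y∈ e with y ∈? map (Path.at p) (upTo (suc l))
    ... | no y∉ = ⊥-elim (none (lose y∈ (e , y∉)))
    ... | yes y∈p with ∈-map⁻ _ y∈p
    ...   | a , a∈ , eq = a , ℕ.≤-pred (∈-upTo⁻ a∈) , sym eq

  -- At the end of a saturated path all neighbours in `Q` lie on the path. Each one other than
  -- `at 1` closes a cycle through the first edge, and `chord-≤` in both directions leaves room for
  -- one such cycle.
  degree≤2 : ∀ Q {q} → q ∈ Q → ∃ λ v → v ∈ Q ×
    (∀ {x y z} → (x ∈ Q × E G v x) → (y ∈ Q × E G v y) → (z ∈ Q × E G v z) →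
      x ≢ y → x ≢ z → y ≢ z → ⊥)
  degree≤2 Q {q} q∈
    with saturated-path Q n (record { at = λ _ → q ; inj = λ { z≤n z≤n _ → refl } ; edge = λ () }) q∈ (ℕ.m≤m+n n 0)
  ... | l , p , start , sat = at 0 , start , λ x y z x≢y x≢z y≢z → pigeon (class x) (class y) (class z) x≢y x≢z y≢z
    where
    open Path p
    Far : Fin n → Set
    Far y = ∃ λ a → 2 + a ≤ l × at (2 + a) ≡ y
    class : ∀ {y} → y ∈ Q × E G (at 0) y → y ≡ at 1 ⊎ (E G (at 0) y × Far y)
    class (y∈ , e) with sat y∈ e
    ... | zero , _ , eq = ⊥-elim (E⇒≢ e eq)
    ... | suc zero , _ , eq = inj₁ (sym eq)
    ... | suc (suc a) , a≤ , eq = inj₂ (e , a , a≤ , eq)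
    far-unique : ∀ {x y} → E G (at 0) x × Far x → E G (at 0) y × Far y → x ≡ y
    far-unique (ex , a , a≤ , refl) (ey , b , b≤ , refl) =
      cong at (ℕ.≤-antisym (chord-≤ p b≤ a≤ (E-sym ey) (E-sym ex)) (chord-≤ p a≤ b≤ (E-sym ex) (E-sym ey)))
    pigeon : ∀ {x y z} → x ≡ at 1 ⊎ (E G (at 0) x × Far x) → y ≡ at 1 ⊎ (E G (at 0) y × Far y) →
      z ≡ at 1 ⊎ (E G (at 0) z × Far z) → x ≢ y → x ≢ z → y ≢ z → ⊥
    pigeon (inj₁ x) (inj₁ y) _ x≢y _ _ = x≢y (trans x (sym y))
    pigeon (inj₁ x) (inj₂ _) (inj₁ z) _ x≢z _ = x≢z (trans x (sym z))
    pigeon (inj₁ _) (inj₂ y) (inj₂ z) _ _ y≢z = y≢z (far-unique y z)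
    pigeon (inj₂ x) (inj₂ y) _ x≢y _ _ = x≢y (far-unique x y)
    pigeon (inj₂ _) (inj₁ y) (inj₁ z) _ _ y≢z = y≢z (trans y (sym z))
    pigeon (inj₂ x) (inj₁ _) (inj₂ z) _ x≢z _ = x≢z (far-unique x z)

  -- Greedily deleting closed neighbourhoods of vertices of degree at most 2 yields a third of
  -- the vertices; the inequality becomes strict at the end, where no triangle can be left.
  independent-third : ∀ fuel Q → length Q ≤ fuel → Unique Q → ∀ {q} → q ∈ Q →
    ∃ λ I → AllPairs Apart I × (∀ {x} → x ∈ I → x ∈ Q) × length Q < 3 * length I
  independent-third zero [] _ _ ()
  independent-third (suc fuel) Q len uniq q∈ with degree≤2 Q q∈
  ... | v , v∈ , deg = branch rest refl
    where
    N = filter (E? v) Q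
    keep? : Decidable λ y → Apart v y
    keep? y = ¬? (v Fin.≟ y) ×-dec ¬? (E? v y)
    rest = filter keep? Q
    N≤2 : length N ≤ 2
    N≤2 with N | Unique.filter⁺ (E? v) uniq | (λ {x} → ∈-filter⁻ (E? v) {v = x} {xs = Q})
    ... | [] | _ | _ = z≤n
    ... | _ ∷ [] | _ | _ = s≤s z≤n
    ... | _ ∷ _ ∷ [] | _ | _ = s≤s (s≤s z≤n)
    ... | x ∷ y ∷ z ∷ _ | (x≢y ∷ x≢z ∷ _) ∷ (y≢z ∷ _) ∷ _ | mem =
      ⊥-elim (deg (mem (here refl)) (mem (there (here refl))) (mem (there (there (here refl)))) x≢y x≢z y≢z)
    cover : ∀ {x} → x ∈ Q → x ∈ v ∷ N ++ rest
    cover {x} x∈ with v Fin.≟ x | E? v x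
    ... | yes refl | _ = here refl
    ... | no _ | yes e = there (∈-++⁺ˡ (∈-filter⁺ (E? v) x∈ e))
    ... | no v≢x | no na = there (∈-++⁺ʳ N (∈-filter⁺ keep? x∈ (v≢x , na)))
    total : length Q ≤ suc (length N + length rest)
    total = ℕ.≤-trans (unique-⊆⇒length≤ uniq cover) (ℕ.≤-reflexive (cong suc (length-++ N)))
    shorter : length rest < length Q
    shorter = filter-notAll keep? Q (lose v∈ λ ap → proj₁ ap refl)
    branch : ∀ r → rest ≡ r →
      ∃ λ I → AllPairs Apart I × (∀ {x} → x ∈ I → x ∈ Q) × length Q < 3 * length I
    branch (r ∷ rs) eq
      with independent-third fuel rest (ℕ.≤-pred (ℕ.≤-trans shorter len)) (Unique.filter⁺ keep? uniq)
             (subst (r ∈_) (sym eq) (here refl))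
    ... | I , ind , sub , lt = v ∷ I , All.tabulate (λ x∈ → proj₂ (∈-filter⁻ keep? {xs = Q} (sub x∈))) ∷ ind
        , (λ { (here refl) → v∈ ; (there x∈) → proj₁ (∈-filter⁻ keep? {xs = Q} (sub x∈)) })
        , (begin-strict
             length Q                          ≤⟨ total ⟩
             suc (length N + length rest)      ≤⟨ s≤s (ℕ.+-monoˡ-≤ (length rest) N≤2) ⟩
             3 + length rest                   <⟨ ℕ.+-monoʳ-< 3 lt ⟩
             3 + 3 * length I                  ≡⟨ sym (ℕ.*-suc 3 (length I)) ⟩
             3 * suc (length I)                ∎)
      where open ℕ.≤-Reasoning
    -- Here `Q` consists of `v` and at most two neighbours. Two neighbours are not adjacent, so both
    -- are taken and 3 < 6; with fewer, `v` alone suffices, as 2 < 3.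
    branch [] eq with N | N≤2 | subst (λ r → length Q ≤ suc (length N + length r)) eq total
                    | (λ {x} → ∈-filter⁻ (E? v) {v = x} {xs = Q}) | Unique.filter⁺ (E? v) uniq
    ... | [] | _ | Q≤1 | _ | _ = [ v ] , [] ∷ [] , (λ { (here refl) → v∈ }) , ℕ.≤-trans (s≤s Q≤1) (s≤s (s≤s z≤n))
    ... | _ ∷ [] | _ | Q≤2 | _ | _ = [ v ] , [] ∷ [] , (λ { (here refl) → v∈ }) , s≤s Q≤2
    ... | a ∷ b ∷ [] | _ | Q≤3 | mem | (a≢b ∷ []) ∷ _ = a ∷ b ∷ []
        , ((a≢b , λ e → △-free v a b (proj₂ (mem (here refl))) e (proj₂ (mem (there (here refl))))) ∷ []) ∷ [] ∷ []
        , (λ { (here refl) → proj₁ (mem (here refl)) ; (there (here refl)) → proj₁ (mem (there (here refl))) })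
        , ℕ.≤-trans (s≤s Q≤3) (s≤s (s≤s (s≤s (s≤s z≤n))))
    ... | _ ∷ _ ∷ _ ∷ _ | s≤s (s≤s ()) | _ | _ | _

-- Minimal paired dominating sets as systems of matched pairs

∃∀⊎∀∃¬ : ∀ {n} {R : Fin n → Fin n → Set} → (∀ x y → Dec (R x y)) →
  (∃ λ x → ∀ y → R x y) ⊎ (∀ x → ∃ λ y → ¬ R x y)
∃∀⊎∀∃¬ {n} {R} R? with Fin.any? (λ x → Fin.all? (R? x))
... | yes found = inj₁ found
... | no none = inj₂ λ x → Fin.¬∀⟶∃¬ n (R x) (R? x) (λ all → none (x , all))

¬-→⁻ : ∀ {A B : Set} → Dec A → ¬ (A → B) → A × ¬ B
¬-→⁻ (yes a) h = a , λ b → h (λ _ → b)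
¬-→⁻ (no ¬a) h = ⊥-elim (h (λ a → ⊥-elim (¬a a)))

module _ {n} (G : Graph n) where
  open Domination G

  -- A paired dominating set of j pairs {w i false, w i true}, retaining two consequences of its
  -- minimality: deleting a pair, or deleting the partners of the ends of an edge between two
  -- pairs (and matching these ends with each other), leaves some vertex undominated.
  record Pairs (j : ℕ) : Set where
    field
      w         : Fin j → Bool → Fin n
      w-inj     : ∀ {i i′ b b′} → w i b ≡ w i′ b′ → i ≡ i′ × b ≡ b′
      w-edge    : ∀ i b → E G (w i b) (w i (not b))
      w-total   : ∀ x → ∃₂ λ i b → E G x (w i b)
      w-private : ∀ i → ∃ λ x → ∀ {i′ b} → E G x (w i′ b) → i′ ≡ i
      w-bridge  : ∀ {i i′ b b′} → i ≢ i′ → E G (w i b) (w i′ b′) →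
        ∃ λ x → ∀ {t c} → E G x (w t c) → (t ≡ i × c ≡ not b) ⊎ (t ≡ i′ × c ≡ not b′)

module MinimalPaired {n} (G : Graph n) {D} (minPaired : MinimalPairedDominating G D) where
  open Domination G

  m : Fin n → Fin n
  m = proj₁ (proj₂ (proj₁ minPaired))

  m∈ : ∀ {x} → x ∈ₛ D → m x ∈ₛ D
  m∈ x∈ = proj₁ (proj₂ (proj₂ (proj₁ minPaired)) _ x∈)

  m-edge : ∀ {x} → x ∈ₛ D → E G x (m x)
  m-edge x∈ = proj₁ (proj₂ (proj₂ (proj₂ (proj₁ minPaired)) _ x∈))

  m-invol : ∀ {x} → x ∈ₛ D → m (m x) ≡ x
  m-invol x∈ = proj₂ (proj₂ (proj₂ (proj₂ (proj₁ minPaired)) _ x∈))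

  neighbour : ∀ x → ∃ λ y → y ∈ₛ D × E G x y
  neighbour x with proj₁ (proj₁ minPaired) x
  ... | inj₁ x∈ = m x , m∈ x∈ , m-edge x∈
  ... | inj₂ (y , y∈ , e) = y , y∈ , E-sym e

  -- Minimality for subsets given by a predicate. Domination is asked in total form, with a
  -- neighbour for members too: in a paired dominating set the partner always provides one.
  irreducible : ∀ {P : Fin n → Set} (P? : Decidable P) → (∀ {x} → P x → x ∈ₛ D) →
    ∀ {x} → x ∈ₛ D → ¬ P x → (m′ : Fin n → Fin n) →
    (∀ {x} → P x → P (m′ x) × E G x (m′ x) × m′ (m′ x) ≡ x) →
    (∀ x → ∃ λ y → P y × E G x y) → ⊥
  irreducible P? sub {x} x∈ ¬px m′ match dom = proj₂ minPaired (subset P?)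
    ((λ y∈ → sub (∈-subset⁻ P? y∈)) , x , x∈ , λ x∈P → ¬px (∈-subset⁻ P? x∈P))
    ( (λ y → let z , pz , e = dom y in inj₂ (z , ∈-subset⁺ P? pz , E-sym e))
    , m′ , λ y y∈ → let p , e , i = match (∈-subset⁻ P? y∈) in ∈-subset⁺ P? p , e , i)

  m-injective : ∀ {x y} → x ∈ₛ D → y ∈ₛ D → m x ≡ m y → x ≡ y
  m-injective x∈ y∈ eq = trans (sym (m-invol x∈)) (trans (cong m eq) (m-invol y∈))

  OnlyNear : (a b x : Fin n) → Set
  OnlyNear a b x = ∀ y → y ∈ₛ D × E G x y → y ≡ a ⊎ y ≡ b

  Except : (a b y : Fin n) → Set
  Except a b y = y ∈ₛ D × ¬ (y ≡ a ⊎ y ≡ b)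

  except? : ∀ a b → Decidable (Except a b)
  except? a b y = (y Subset.∈? D) ×-dec ¬? ((y Fin.≟ a) ⊎-dec (y Fin.≟ b))

  -- The alternative behind both reductions: deleting `a` and `b` from `D` either strips some vertex
  -- of all its neighbours in `D` or leaves a totally dominating set.
  private-or-dominating : ∀ a b → ∃ (OnlyNear a b) ⊎ (∀ x → ∃ λ y → Except a b y × E G x y)
  private-or-dominating a b with ∃∀⊎∀∃¬ (λ x y → ((y Subset.∈? D) ×-dec E? x y) →-dec ((y Fin.≟ a) ⊎-dec (y Fin.≟ b)))
  ... | inj₁ found = inj₁ found
  ... | inj₂ dom = inj₂ λ x → let y , ¬near = dom x
                                  (y∈ , e) , ne = ¬-→⁻ ((y Subset.∈? D) ×-dec E? x y) ¬near
                              in y , (y∈ , ne) , e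

  -- `m` still matches what remains after `d` and `m d` are deleted, so domination has to fail.
  pair-private : ∀ {d} → d ∈ₛ D → ∃ (OnlyNear d (m d))
  pair-private {d} d∈ with private-or-dominating d (m d)
  ... | inj₁ found = found
  ... | inj₂ dom = ⊥-elim (irreducible (except? d (m d)) proj₁ d∈ (λ p → proj₂ p (inj₁ refl)) m match dom)
    where
    match : ∀ {x} → Except d (m d) x → Except d (m d) (m x) × E G x (m x) × m (m x) ≡ x
    match (x∈ , ne) = (m∈ x∈ , λ { (inj₁ eq) → ne (inj₂ (trans (sym (m-invol x∈)) (cong m eq)))
                                 ; (inj₂ eq) → ne (inj₁ (m-injective x∈ d∈ eq)) })
                    , m-edge x∈ , m-invol x∈

  -- After `m c` and `m d` are deleted, the edge from `c` to `d` replaces the two lost matching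
  -- edges; the rest keeps its partners, so domination has to fail.
  bridge-private : ∀ {c d} → c ∈ₛ D → d ∈ₛ D → d ≢ m c → E G c d → ∃ (OnlyNear (m c) (m d))
  bridge-private {c} {d} c∈ d∈ d≢mc cd with private-or-dominating (m c) (m d)
  ... | inj₁ found = found
  ... | inj₂ dom = ⊥-elim (irreducible (except? (m c) (m d)) proj₁ (m∈ c∈) (λ p → proj₂ p (inj₁ refl)) m′ match dom)
    where
    m′ : Fin n → Fin n
    m′ x with x Fin.≟ c | x Fin.≟ d
    ... | yes _ | _ = d
    ... | no _ | yes _ = c
    ... | no _ | no _ = m x
    m′-c : m′ c ≡ d
    m′-c with c Fin.≟ c | c Fin.≟ d
    ... | yes _ | _ = refl
    ... | no ne | _ = ⊥-elim (ne refl)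
    m′-d : m′ d ≡ c
    m′-d with d Fin.≟ c | d Fin.≟ d
    ... | yes refl | _ = refl
    ... | no _ | yes _ = refl
    ... | no _ | no ne = ⊥-elim (ne refl)
    m′-other : ∀ {x} → x ≢ c → x ≢ d → m′ x ≡ m x
    m′-other {x} x≢c x≢d with x Fin.≟ c | x Fin.≟ d
    ... | yes eq | _ = ⊥-elim (x≢c eq)
    ... | no _ | yes eq = ⊥-elim (x≢d eq)
    ... | no _ | no _ = refl
    m-flip : ∀ {x y} → x ∈ₛ D → m x ≡ y → x ≡ m y
    m-flip x∈ eq = trans (sym (m-invol x∈)) (cong m eq)
    match : ∀ {x} → Except (m c) (m d) x → Except (m c) (m d) (m′ x) × E G x (m′ x) × m′ (m′ x) ≡ x
    match {x} (x∈ , ne) = by-cases (x Fin.≟ c) (x Fin.≟ d)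
      where
      Goal : Fin n → Set
      Goal y = Except (m c) (m d) y × E G x y × m′ y ≡ x
      by-cases : Dec (x ≡ c) → Dec (x ≡ d) → Goal (m′ x)
      by-cases (yes refl) _ = subst Goal (sym m′-c)
        ((d∈ , λ { (inj₁ eq) → d≢mc eq ; (inj₂ eq) → E⇒≢ (m-edge d∈) eq }) , cd , m′-d)
      by-cases (no _) (yes refl) = subst Goal (sym m′-d)
        ((c∈ , λ { (inj₁ eq) → E⇒≢ (m-edge c∈) eq ; (inj₂ eq) → d≢mc (m-flip d∈ (sym eq)) }) , E-sym cd , m′-c)
      by-cases (no x≢c) (no x≢d) = subst Goal (sym (m′-other x≢c x≢d))
        ( (m∈ x∈ , λ { (inj₁ eq) → x≢c (m-injective x∈ c∈ eq) ; (inj₂ eq) → x≢d (m-injective x∈ d∈ eq) })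
        , m-edge x∈
        , trans (m′-other (λ eq → ne (inj₁ (m-flip x∈ eq))) (λ eq → ne (inj₂ (m-flip x∈ eq)))) (m-invol x∈))

  -- Each matched pair is represented by its endpoint of smaller number, so it is listed exactly
  -- once.
  rep? : Decidable λ x → x ∈ₛ D × toℕ x < toℕ (m x)
  rep? x = (x Subset.∈? D) ×-dec (toℕ x ℕ.<? toℕ (m x))

  reps : List (Fin n)
  reps = filter rep? (allFin n)

  mate : Fin (length reps) → Bool → Fin n
  mate i false = lookup reps i
  mate i true = m (lookup reps i)

  reps-property : ∀ i → lookup reps i ∈ₛ D × toℕ (lookup reps i) < toℕ (m (lookup reps i))
  reps-property i = proj₂ (∈-filter⁻ rep? {xs = allFin n} (∈-lookup i))

  mate∈ : ∀ i b → mate i b ∈ₛ D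
  mate∈ i false = proj₁ (reps-property i)
  mate∈ i true = m∈ (proj₁ (reps-property i))

  mate-not : ∀ i b → mate i (not b) ≡ m (mate i b)
  mate-not i false = refl
  mate-not i true = sym (m-invol (mate∈ i false))

  rep∈ : ∀ {x} → x ∈ₛ D → toℕ x < toℕ (m x) → x ∈ reps
  rep∈ {x} x∈ lt = ∈-filter⁺ rep? (∈-allFin x) (x∈ , lt)

  rep∈⊎m-rep∈ : ∀ {x} → x ∈ₛ D → x ∈ reps ⊎ m x ∈ reps
  rep∈⊎m-rep∈ {x} x∈ with ℕ.<-cmp (toℕ x) (toℕ (m x))
  ... | tri< lt _ _ = inj₁ (rep∈ x∈ lt)
  ... | tri≈ _ eq _ = ⊥-elim (E⇒≢ (m-edge x∈) (Fin.toℕ-injective eq))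
  ... | tri> _ _ gt = inj₂ (rep∈ (m∈ x∈) (subst (λ y → toℕ (m x) < toℕ y) (sym (m-invol x∈)) gt))

  mate-index : ∀ {x} → x ∈ₛ D → ∃₂ λ i b → x ≡ mate i b
  mate-index {x} x∈ with rep∈⊎m-rep∈ x∈
  ... | inj₁ r = Any.index r , false , Any.lookup-index r
  ... | inj₂ r = Any.index r , true , trans (sym (m-invol x∈)) (cong m (Any.lookup-index r))

  mate-injective : ∀ {i i′ b b′} → mate i b ≡ mate i′ b′ → i ≡ i′ × b ≡ b′
  mate-injective {b = false} {false} eq =
    lookup-injective (Unique.filter⁺ rep? (Unique.allFin⁺ n)) eq , refl
  mate-injective {i} {i′} {b = true} {true} eq =
    lookup-injective (Unique.filter⁺ rep? (Unique.allFin⁺ n)) (m-injective (mate∈ i false) (mate∈ i′ false) eq) , refl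
  mate-injective {i} {i′} {b = false} {true} eq with reps-property i
  ... | _ , lt rewrite eq | m-invol (mate∈ i′ false) = ⊥-elim (ℕ.<-asym lt (proj₂ (reps-property i′)))
  mate-injective {i} {i′} {b = true} {false} eq with reps-property i′
  ... | _ , lt rewrite sym eq | m-invol (mate∈ i false) = ⊥-elim (ℕ.<-asym lt (proj₂ (reps-property i)))

  pairs : Pairs G (length reps)
  pairs = record
    { w = mate
    ; w-inj = mate-injective
    ; w-edge = λ i b → subst (E G (mate i b)) (sym (mate-not i b)) (m-edge (mate∈ i b))
    ; w-total = total
    ; w-private = λ i → let x , only = pair-private (mate∈ i false) in
        x , λ {i′} {b} e → [ (λ eq → proj₁ (mate-injective {i′} {i} {b} {false} eq))
                           , (λ eq → proj₁ (mate-injective {i′} {i} {b} {true} eq)) ]′ (only _ (mate∈ i′ b , e))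
    ; w-bridge = bridge
    }
    where
    total : ∀ x → ∃₂ λ i b → E G x (mate i b)
    total x with neighbour x
    ... | y , y∈ , e with mate-index y∈
    ... | i , b , refl = i , b , e
    bridge : ∀ {i i′ b b′} → i ≢ i′ → E G (mate i b) (mate i′ b′) →
      ∃ λ x → ∀ {t c} → E G x (mate t c) → (t ≡ i × c ≡ not b) ⊎ (t ≡ i′ × c ≡ not b′)
    bridge {i} {i′} {b} {b′} ne e
      with bridge-private (mate∈ i b) (mate∈ i′ b′)
             (λ eq → ne (sym (proj₁ (mate-injective {i′} {i} {b′} {not b} (trans eq (sym (mate-not i b))))))) e
    ... | x , only = x , λ {t} {c} e →
      [ (λ eq → inj₁ (mate-injective {t} {i} {c} {not b} (trans eq (sym (mate-not i b)))))
      , (λ eq → inj₂ (mate-injective {t} {i′} {c} {not b′} (trans eq (sym (mate-not i′ b′))))) ]′ (only _ (mate∈ t c , e))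

  ∣D∣≤ : ∣ D ∣ ≤ 2 * length reps
  ∣D∣≤ = ℕ.≤-trans (∣∣≤length cover) (ℕ.≤-reflexive len)
    where
    cover : ∀ {x} → x ∈ₛ D → x ∈ reps ++ map m reps
    cover {x} x∈ with rep∈⊎m-rep∈ x∈
    ... | inj₁ r = ∈-++⁺ˡ r
    ... | inj₂ r = ∈-++⁺ʳ reps (subst (_∈ map m reps) (m-invol x∈) (∈-map⁺ m r))
    len : length (reps ++ map m reps) ≡ 2 * length reps
    len rewrite length-++ reps {map m reps} | length-map m reps | ℕ.+-identityʳ (length reps) = refl

-- A leaf in every pair

module _ {n} (G : Graph n) where
  open Domination G

  -- The case of Pairs in which every u i is a leaf of the graph induced by all u i and v i.
  record Corona (j : ℕ) : Set where
    field
      u v       : Fin j → Fin n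
      u-inj     : ∀ {i l} → u i ≡ u l → i ≡ l
      v-inj     : ∀ {i l} → v i ≡ v l → i ≡ l
      u≢v       : ∀ {i l} → u i ≢ v l
      uv-edge   : ∀ i → E G (u i) (v i)
      ¬uu-edge  : ∀ {i l} → ¬ E G (u i) (u l)
      uv-edge⇒≡ : ∀ {i l} → E G (u i) (v l) → i ≡ l
      total     : ∀ x → ∃ λ i → E G x (u i) ⊎ E G x (v i)
      bridge    : ∀ {i l} → i ≢ l → E G (v i) (v l) →
        ∃ λ x → (∀ {t} → ¬ E G x (v t)) × (∀ {t} → E G x (u t) → t ≡ i ⊎ t ≡ l)

b≢not-b : ∀ {b} → b ≢ not b
b≢not-b {true} ()
b≢not-b {false} ()

-- Pairs without an endpoint that is a leaf of G[D] come with an external private neighbour, so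
-- they span three vertices each; independent-third would find more than one vertex per pair.
module EveryPairHasLeaf {n} (G : Graph n) (cactus : Cactus G) (△-free : TriangleFree G)
  {j} (pairs : Pairs G j) (indep≤ : ∀ {I} → AllPairs (Domination.Apart G) I → length I ≤ j) where
  open Domination G
  open LowDegree G cactus △-free
  open Pairs pairs

  InPairs : Fin n → Set
  InPairs x = ∃₂ λ i b → w i b ≡ x

  inPairs? : Decidable InPairs
  inPairs? x with Fin.any? (λ i → (w i false Fin.≟ x) ⊎-dec (w i true Fin.≟ x))
  ... | yes (i , inj₁ eq) = yes (i , false , eq)
  ... | yes (i , inj₂ eq) = yes (i , true , eq)
  ... | no none = no λ { (i , false , eq) → none (i , inj₁ eq) ; (i , true , eq) → none (i , inj₂ eq) }

  OnlySees : Fin n → Fin j → Set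
  OnlySees x i = ∀ {i′ b} → E G x (w i′ b) → i′ ≡ i

  Leaf : Fin j → Fin n → Set
  Leaf i x = (∃ λ b → w i b ≡ x) × OnlySees x i

  External : Fin j → Fin n → Set
  External i x = ¬ InPairs x × OnlySees x i

  Trio : Fin j → Fin n → Set
  Trio i x = (∃ λ b → w i b ≡ x) ⊎ External i x

  leaf-or-external : ∀ i → ∃ (Leaf i) ⊎ ∃ (External i)
  leaf-or-external i with w-private i
  ... | x , only with inPairs? x
  ...   | no out = inj₂ (x , out , only)
  ...   | yes (i′ , b , refl) with only (w-edge i′ b)
  ...     | refl = inj₁ (w i′ b , (b , refl) , only)

  sees-unique : ∀ {i i′ x} → OnlySees x i → OnlySees x i′ → i ≡ i′
  sees-unique {x = x} o o′ with w-total x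
  ... | _ , _ , e = trans (sym (o e)) (o′ e)

  trio-unique : ∀ {i i′ x} → Trio i x → Trio i′ x → i ≡ i′
  trio-unique (inj₁ (b , refl)) (inj₁ (b′ , eq)) = sym (proj₁ (w-inj eq))
  trio-unique (inj₁ (b , eq)) (inj₂ (out , _)) = ⊥-elim (out (_ , b , eq))
  trio-unique (inj₂ (out , _)) (inj₁ (b , eq)) = ⊥-elim (out (_ , b , eq))
  trio-unique (inj₂ (_ , o)) (inj₂ (_ , o′)) = sees-unique o o′

  -- A leaf sees no other pair, and an external private neighbour sees only its own. Hence leaves of
  -- some pairs can be added to any independent set found in the trios of the others.
  leaf-trio-apart : ∀ {i i′ x y} → i ≢ i′ → Leaf i x → Trio i′ y → Apart x y
  leaf-trio-apart i≢i′ leaf trio =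
    (λ { refl → i≢i′ (trio-unique (inj₁ (proj₁ leaf)) trio) }) , not-adjacent leaf trio
    where
    not-adjacent : ∀ {x y} → Leaf _ x → Trio _ y → ¬ E G x y
    not-adjacent (_ , only) (inj₁ (b , refl)) e = i≢i′ (sym (only e))
    not-adjacent ((b , refl) , _) (inj₂ (_ , only)) e = i≢i′ (only (E-sym e))

  -- A pair with a leaf contributes that leaf, any other pair its two ends and an external private
  -- neighbour. In `size` a leaf weighs 3, so that every pair has the same weight.
  record Split (is : List (Fin j)) : Set where
    field
      leaves trios : List (Fin n)
      leaves-from : All (λ x → ∃ λ i → i ∈ is × Leaf i x) leaves
      trios-from  : All (λ x → ∃ λ i → i ∈ is × Trio i x) trios
      independent : AllPairs Apart leaves
      unique      : Unique trios
      cross       : All (λ x → All (Apart x) trios) leaves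
      size        : length trios + 3 * length leaves ≡ 3 * length is
      status      : (∀ {i} → i ∈ is → ∃ (Leaf i)) ⊎ ∃ (_∈ trios)

  split : ∀ {is} → Unique is → Split is
  split [] = record
    { leaves = [] ; trios = [] ; leaves-from = [] ; trios-from = [] ; independent = [] ; unique = []
    ; cross = [] ; size = refl ; status = inj₁ λ () }
  split {i ∷ is} (i# ∷ uniq) with split uniq | leaf-or-external i
  ... | S | inj₁ (x , leaf) = record
    { leaves = x ∷ leaves
    ; trios = trios
    ; leaves-from = (i , here refl , leaf) ∷ All.map (λ (i , i∈ , p) → i , there i∈ , p) leaves-from
    ; trios-from = All.map (λ (i , i∈ , p) → i , there i∈ , p) trios-from
    ; independent = All.map (λ (i , i∈ , at , _) → leaf-trio-apart (All.lookup i# i∈) leaf (inj₁ at)) leaves-from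
        ∷ independent
    ; unique = unique
    ; cross = All.map (λ (i , i∈ , trio) → leaf-trio-apart (All.lookup i# i∈) leaf trio) trios-from ∷ cross
    ; size = size′
    ; status = [ (λ leafy → inj₁ λ { (here refl) → x , leaf ; (there i∈) → leafy i∈ }) , inj₂ ]′ status
    }
    where
    open Split S
    size′ : length trios + 3 * suc (length leaves) ≡ 3 * suc (length is)
    size′ = begin
      length trios + 3 * suc (length leaves)   ≡⟨ cong (length trios +_) (ℕ.*-suc 3 (length leaves)) ⟩
      length trios + (3 + 3 * length leaves)   ≡⟨ sym (ℕ.+-assoc (length trios) 3 _) ⟩
      length trios + 3 + 3 * length leaves     ≡⟨ cong (_+ 3 * length leaves) (ℕ.+-comm (length trios) 3) ⟩
      3 + (length trios + 3 * length leaves)   ≡⟨ cong (3 +_) size ⟩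
      3 + 3 * length is                        ≡⟨ sym (ℕ.*-suc 3 (length is)) ⟩
      3 * suc (length is)                      ∎
      where open ≡-Reasoning
  ... | S | inj₂ (p , out , only) = record
    { leaves = leaves
    ; trios = p ∷ w i true ∷ w i false ∷ trios
    ; leaves-from = All.map (λ (i , i∈ , p) → i , there i∈ , p) leaves-from
    ; trios-from = (i , here refl , trio-p) ∷ (i , here refl , trio true) ∷ (i , here refl , trio false)
        ∷ All.map (λ (i , i∈ , p) → i , there i∈ , p) trios-from
    ; independent = independent
    ; unique = ((λ eq → out (i , true , sym eq)) ∷ (λ eq → out (i , false , sym eq)) ∷ fresh trio-p)
        ∷ ((λ eq → b≢not-b (proj₂ (w-inj eq))) ∷ fresh (trio true)) ∷ fresh (trio false) ∷ unique
    ; cross = All.zipWith (λ ((i , i∈ , leaf) , aparts) →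
          apart i∈ leaf trio-p ∷ apart i∈ leaf (trio true) ∷ apart i∈ leaf (trio false) ∷ aparts)
        (leaves-from , cross)
    ; size = trans (cong (3 +_) size) (sym (ℕ.*-suc 3 (length is)))
    ; status = inj₂ (p , here refl)
    }
    where
    open Split S
    trio-p : Trio i p
    trio-p = inj₂ (out , only)
    trio : ∀ b → Trio i (w i b)
    trio b = inj₁ (b , refl)
    apart : ∀ {i′ x y} → i′ ∈ is → Leaf i′ x → Trio i y → Apart x y
    apart i∈ = leaf-trio-apart (λ eq → All.lookup i# i∈ (sym eq))
    fresh : ∀ {x} → Trio i x → All (x ≢_) trios
    fresh t = All.map (λ (i′ , i′∈ , t′) → λ { refl → All.lookup i# i′∈ (trio-unique t t′) }) trios-from

  abstract
   -- If there were a trio, more than a third of all trio vertices would form an independent set;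
   -- together with the leaves it has, by `size`, more than `j` vertices.
   leaf-of : ∀ i → ∃ (Leaf i)
   leaf-of i = [ (λ leafy → leafy (∈-allFin i)) , (λ (_ , q∈) → ⊥-elim (too-many q∈)) ]′ status
     where
     open Split (split (Unique.allFin⁺ j))
     too-many : ∀ {q} → q ∈ trios → ⊥
     too-many q∈ with independent-third (length trios) trios ℕ.≤-refl unique q∈
     ... | I , ind , sub , lt = ℕ.<⇒≱ (ℕ.*-cancelˡ-< 3 j (length (I ++ leaves)) more)
       (indep≤ (AllPairs.++⁺ ind independent
         (All.tabulate λ x∈ → All.map (λ aparts → Apart-sym (All.lookup aparts (sub x∈))) cross)))
       where
       open ℕ.≤-Reasoning
       more : 3 * j < 3 * length (I ++ leaves)
       more = begin-strict
         3 * j                               ≡⟨ cong (3 *_) (sym (length-tabulate {n = j} id)) ⟩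
         3 * length (allFin j)               ≡⟨ sym size ⟩
         length trios + 3 * length leaves    <⟨ ℕ.+-monoˡ-< (3 * length leaves) lt ⟩
         3 * length I + 3 * length leaves    ≡⟨ sym (ℕ.*-distribˡ-+ 3 (length I) (length leaves)) ⟩
         3 * (length I + length leaves)      ≡⟨ cong (3 *_) (sym (length-++ I)) ⟩
         3 * length (I ++ leaves)            ∎

  corona : Corona G j
  corona = record
    { u = λ i → w i (side i)
    ; v = λ i → w i (not (side i))
    ; u-inj = λ eq → proj₁ (w-inj eq)
    ; v-inj = λ eq → proj₁ (w-inj eq)
    ; u≢v = λ eq → clash (w-inj eq)
    ; uv-edge = λ i → w-edge i (side i)
    ; ¬uu-edge = ¬uu
    ; uv-edge⇒≡ = λ e → sym (only e)
    ; total = total′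
    -- The ends of the edge are `v i` and `v l`, so the vertex from `w-bridge` can see only their
    -- partners `u i` and `u l`, and no `v t` at all.
    ; bridge = λ {i} {l} ne e → let x , sees = w-bridge ne e in x
        , (λ f → [ (λ (eq , side≡) → side-clash eq side≡) , (λ (eq , side≡) → side-clash eq side≡) ]′ (sees f))
        , λ f → [ (λ p → inj₁ (proj₁ p)) , (λ p → inj₂ (proj₁ p)) ]′ (sees f)
    }
    where
    side : Fin j → Bool
    side i = proj₁ (proj₁ (proj₂ (leaf-of i)))
    only : ∀ {i} → OnlySees (w i (side i)) i
    only {i} e with leaf-of i
    ... | _ , (b , refl) , only = only e
    clash : ∀ {i l} → i ≡ l × side i ≡ not (side l) → ⊥
    clash (refl , eq) = b≢not-b eq
    side-clash : ∀ {i t} → t ≡ i → not (side t) ≡ not (not (side i)) → ⊥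
    side-clash refl eq = b≢not-b eq
    ¬uu : ∀ {i l} → ¬ E G (w i (side i)) (w l (side l))
    ¬uu {i} {l} e with only e
    ... | refl = E⇒≢ e refl
    total′ : ∀ x → ∃ λ i → E G x (w i (side i)) ⊎ E G x (w i (not (side i)))
    total′ x with w-total x
    ... | i , b , e with b Bool.≟ side i
    ...   | yes refl = i , inj₁ e
    ...   | no ne = i , inj₂ (subst (λ c → E G x (w i c)) (Bool.¬-not ne) e)

-- The 5-cycles through vertices outside the pairs

module PentagonStructure {n} (G : Graph n) (cactus : Cactus G) (△-free : TriangleFree G) {j} (corona : Corona G j)
  (Γ≤j : ∀ D → MinimalDominating G D → ∣ D ∣ ≤ j) where
  open Domination G
  open Corona corona

  Out : Fin n → Set
  Out x = (∀ {i} → x ≢ u i) × (∀ {i} → x ≢ v i)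

  data Position : Fin n → Set where
    at-u : ∀ i → Position (u i)
    at-v : ∀ i → Position (v i)
    out  : ∀ {x} → Out x → Position x

  position : ∀ x → Position x
  position x with Fin.any? (λ i → x Fin.≟ u i) | Fin.any? (λ i → x Fin.≟ v i)
  ... | yes (i , refl) | _ = at-u i
  ... | no _ | yes (i , refl) = at-v i
  ... | no ¬u | no ¬v = out ((λ eq → ¬u (_ , eq)) , λ eq → ¬v (_ , eq))

  vv⇒≢ : ∀ {i l} → E G (v i) (v l) → i ≢ l
  vv⇒≢ e refl = E⇒≢ e refl

  -- With the matching edges at `i` and `l` this is the 5-cycle `r`, `u i`, `v i`, `v l`, `u l`,
  -- with apex `r` outside the pairs.
  record Pentagon (r : Fin n) (i l : Fin j) : Set where
    constructor pentagon
    field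
      isOut : Out r
      ru    : E G r (u i)
      ru′   : E G r (u l)
      vv    : E G (v i) (v l)

  pentagon-sym : ∀ {r i l} → Pentagon r i l → Pentagon r l i
  pentagon-sym (pentagon o e e′ f) = pentagon o e′ e (E-sym f)

  -- Otherwise r together with v i for each neighbour u i of r, and all other u i, is independent.
  out⇒pentagon : ∀ {r} → Out r → ∃₂ λ i l → Pentagon r i l
  out⇒pentagon {r} (r≢u , r≢v)
    with Fin.any? (λ i → Fin.any? (λ l → E? r (u i) ×-dec (E? r (u l) ×-dec E? (v i) (v l))))
  ... | yes (i , l , e , e′ , f) = i , l , pentagon (r≢u , r≢v) e e′ f
  ... | no none = ⊥-elim (ℕ.<⇒≱ (ℕ.≤-reflexive (cong suc (sym (length-tabulate g))))
                    (independent-bound Γ≤j (All.tabulate⁺ r-apart ∷ AllPairs.tabulate⁺ apart)))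
    where
    g : Fin j → Fin n
    g i with E? r (u i)
    ... | yes _ = v i
    ... | no _ = u i
    r-apart : ∀ i → Apart r (g i)
    r-apart i with E? r (u i)
    ... | yes e = r≢v , λ e′ → △-free r (u i) (v i) e (uv-edge i) e′
    ... | no ¬e = r≢u , ¬e
    apart : ∀ {i l} → i ≢ l → Apart (g i) (g l)
    apart {i} {l} i≢l with E? r (u i) | E? r (u l)
    ... | yes e | yes e′ = (λ eq → i≢l (v-inj eq)) , λ f → none (i , l , e , e′ , f)
    ... | yes _ | no _ = (λ eq → u≢v (sym eq)) , λ f → i≢l (sym (uv-edge⇒≡ (E-sym f)))
    ... | no _ | yes _ = u≢v , λ f → i≢l (uv-edge⇒≡ f)
    ... | no _ | no _ = (λ eq → i≢l (u-inj eq)) , ¬uu-edge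

  cycle : ∀ {r i l} → Pentagon r i l → Cycle G
  cycle {r} {i} {l} (pentagon (r≢u , r≢v) ru ru′ vv) = record
    { len = 2
    ; vert = lookup (r ∷ u i ∷ v i ∷ v l ∷ u l ∷ [])
    ; inj = lookup-injective
        ( (r≢u ∷ r≢v ∷ r≢v ∷ r≢u ∷ [])
        ∷ (u≢v ∷ u≢v ∷ (λ eq → vv⇒≢ vv (u-inj eq)) ∷ [])
        ∷ ((λ eq → vv⇒≢ vv (v-inj eq)) ∷ (λ eq → u≢v (sym eq)) ∷ [])
        ∷ ((λ eq → u≢v (sym eq)) ∷ [])
        ∷ [] ∷ [])
    ; edges = λ { zero → ru ; (suc zero) → uv-edge i ; (suc (suc zero)) → vv
                ; (suc (suc (suc zero))) → E-sym (uv-edge l) ; (suc (suc (suc (suc zero)))) → E-sym ru′ }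
    }

  -- Both cycles contain the edge `u i v i`, so the cactus property gives them the same edges.
  -- Locating `r u i` and `v i v l` among the edges of the second cycle identifies the apexes and
  -- the far indices.
  pentagon-unique : ∀ {r r′ i l l′} → Pentagon r i l → Pentagon r′ i l′ → r ≡ r′ × l ≡ l′
  pentagon-unique {r} {r′} {i} {l} {l′} p p′ = apex (transfer r (u i) (zero , inj₁ (refl , refl)))
                                             , far (transfer (v i) (v l) (suc (suc zero) , inj₁ (refl , refl)))
    where
    open Pentagon
    transfer : ∀ x y → OnCycle G (cycle p) x y → OnCycle G (cycle p′) x y
    transfer x y = proj₁ (cactus (cycle p) (cycle p′) (u i) (v i)
      (suc zero , inj₁ (refl , refl)) (suc zero , inj₁ (refl , refl)) x y)
    not-u : ∀ {t} {A : Set} → u t ≡ r → A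
    not-u eq = ⊥-elim (proj₁ (isOut p) (sym eq))
    not-v : ∀ {t} {A : Set} → v t ≡ r → A
    not-v eq = ⊥-elim (proj₂ (isOut p) (sym eq))
    apex : OnCycle G (cycle p′) r (u i) → r ≡ r′
    apex (zero , inj₁ (eq , _)) = sym eq
    apex (suc zero , inj₁ (eq , _)) = not-u eq
    apex (suc (suc zero) , inj₁ (eq , _)) = not-v eq
    apex (suc (suc (suc zero)) , inj₁ (eq , _)) = not-v eq
    apex (suc (suc (suc (suc zero))) , inj₁ (eq , _)) = not-u eq
    apex (zero , inj₂ (_ , eq)) = not-u eq
    apex (suc zero , inj₂ (_ , eq)) = not-v eq
    apex (suc (suc zero) , inj₂ (_ , eq)) = not-v eq
    apex (suc (suc (suc zero)) , inj₂ (_ , eq)) = not-u eq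
    apex (suc (suc (suc (suc zero))) , inj₂ (_ , eq)) = sym eq
    far : OnCycle G (cycle p′) (v i) (v l) → l ≡ l′
    far (zero , inj₁ (eq , _)) = ⊥-elim (proj₂ (isOut p′) eq)
    far (suc zero , inj₁ (eq , _)) = ⊥-elim (u≢v eq)
    far (suc (suc zero) , inj₁ (_ , eq)) = sym (v-inj eq)
    far (suc (suc (suc zero)) , inj₁ (_ , eq)) = ⊥-elim (u≢v eq)
    far (suc (suc (suc (suc zero))) , inj₁ (eq , _)) = ⊥-elim (u≢v eq)
    far (zero , inj₂ (eq , _)) = ⊥-elim (proj₂ (isOut p′) eq)
    far (suc zero , inj₂ (eq , _)) = ⊥-elim (u≢v eq)
    far (suc (suc zero) , inj₂ (eq , _)) = ⊥-elim (vv⇒≢ (vv p) (v-inj eq))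
    far (suc (suc (suc zero)) , inj₂ (_ , eq)) = ⊥-elim (u≢v eq)
    far (suc (suc (suc (suc zero))) , inj₂ (eq , _)) = ⊥-elim (u≢v eq)

  OnlySeesBases : Fin n → Fin j → Fin j → Set
  OnlySeesBases x i l = (∀ {t} → ¬ E G x (v t)) × (∀ {t} → E G x (u t) → t ≡ i ⊎ t ≡ l)

  -- The vertex given by `bridge` sees no `v`, so it is no `u t`; it is no `v t` either, since then
  -- `t` would be `i` or `l` and it would see the other end of the edge. Hence it is outside, and
  -- its pentagon can only stand on `i` and `l`.
  vv⇒pentagon : ∀ {i l} → E G (v i) (v l) → ∃ λ x → Pentagon x i l × OnlySeesBases x i l
  vv⇒pentagon {i} {l} e with bridge (vv⇒≢ e) e
  ... | x , ¬xv , xu = x , apex (position x) ¬xv xu , ¬xv , xu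
    where
    apex : ∀ {x} → Position x → (∀ {t} → ¬ E G x (v t)) → (∀ {t} → E G x (u t) → t ≡ i ⊎ t ≡ l) → Pentagon x i l
    apex (at-u t) ¬xv xu = ⊥-elim (¬xv (uv-edge t))
    apex (at-v t) ¬xv xu with xu (E-sym (uv-edge t))
    ... | inj₁ refl = ⊥-elim (¬xv e)
    ... | inj₂ refl = ⊥-elim (¬xv (E-sym e))
    apex (out o) ¬xv xu with out⇒pentagon o
    ... | a , c , p@(pentagon _ xa xc ac) with xu xa | xu xc
    ...   | inj₁ refl | inj₁ refl = ⊥-elim (vv⇒≢ ac refl)
    ...   | inj₁ refl | inj₂ refl = p
    ...   | inj₂ refl | inj₁ refl = pentagon-sym p
    ...   | inj₂ refl | inj₂ refl = ⊥-elim (vv⇒≢ ac refl)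

  -- By uniqueness `r` is the vertex that `bridge` supplies for the edge `v i v l`, and so inherits
  -- its restricted neighbourhood.
  pentagon-neighbours : ∀ {r i l} → Pentagon r i l → OnlySeesBases r i l
  pentagon-neighbours p with vv⇒pentagon (Pentagon.vv p)
  ... | x , q , sees with pentagon-unique p q
  ... | refl , _ = sees

  -- Both edges lie on pentagons through `u i v i`, and these coincide.
  vv-unique : ∀ {i l l′} → E G (v i) (v l) → E G (v i) (v l′) → l ≡ l′
  vv-unique e e′ = proj₂ (pentagon-unique (proj₁ (proj₂ (vv⇒pentagon e))) (proj₁ (proj₂ (vv⇒pentagon e′))))

  -- Given an edge rs between apexes of pentagons, replace u by v in the pentagon of s and
  -- add r: every member of the resulting set of size j + 1 has a private neighbour.
  out-independent : ∀ {r s} → Out r → Out s → ¬ E G r s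
  out-independent {r} {s} r-out s-out rs with out⇒pentagon r-out | out⇒pentagon s-out
  ... | i , l , p | a , c , q = ℕ.<⇒≱ (ℕ.≤-reflexive (sym size)) (Γ≤j _ (private-neighbours⇒minimal dom priv))
    where
    open Pentagon
    B : Fin j → Set
    B t = t ≡ a ⊎ t ≡ c
    B? : Decidable B
    B? t = (t Fin.≟ a) ⊎-dec (t Fin.≟ c)
    s-apex : ∀ {x t t′} → B t → Pentagon x t t′ → x ≡ s
    s-apex (inj₁ refl) p = proj₁ (pentagon-unique p q)
    s-apex (inj₂ refl) p = proj₁ (pentagon-unique p (pentagon-sym q))
    -- `u a` and `u c` are to be private to `v a` and `v c`, so `r` must not see them: a common base
    -- would make the two apexes equal.
    r-misses : ∀ {t} → B t → ¬ E G r (u t)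
    r-misses b e with proj₂ (pentagon-neighbours p) e
    ... | inj₁ refl = E⇒≢ rs (s-apex b p)
    ... | inj₂ refl = E⇒≢ rs (s-apex b (pentagon-sym p))
    -- For a pair left unchanged, `v t` is to be private to `u t`; so it must not see the new
    -- members `v a` and `v c`.
    vv-closed : ∀ {t t′} → B t → E G (v t) (v t′) → B t′
    vv-closed (inj₁ refl) e = inj₂ (vv-unique e (vv q))
    vv-closed (inj₂ refl) e = inj₁ (vv-unique e (E-sym (vv q)))
    s-sees : ∀ {t} → E G s (u t) → B t
    s-sees = proj₂ (pentagon-neighbours q)

    data Choice (t : Fin j) : Fin n → Fin n → Set where
      swapped : B t → Choice t (v t) (u t)
      kept    : ¬ B t → Choice t (u t) (v t)
    -- `g t` is the member taken from the pair `t`, and the other end `h t` will be its private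
    -- neighbour; that of `r` will be `s`.
    g h : Fin j → Fin n
    g t with B? t
    ... | yes _ = v t
    ... | no _ = u t
    h t with B? t
    ... | yes _ = u t
    ... | no _ = v t
    choice : ∀ t → Choice t (g t) (h t)
    choice t with B? t
    ... | yes b = swapped b
    ... | no ¬b = kept ¬b

    g-injective : ∀ {t t′} → g t ≡ g t′ → t ≡ t′
    g-injective {t} {t′} eq with g t | h t | choice t | g t′ | h t′ | choice t′
    ... | _ | _ | swapped _ | _ | _ | swapped _ = v-inj eq
    ... | _ | _ | swapped _ | _ | _ | kept _ = ⊥-elim (u≢v (sym eq))
    ... | _ | _ | kept _ | _ | _ | swapped _ = ⊥-elim (u≢v eq)
    ... | _ | _ | kept _ | _ | _ | kept _ = u-inj eq
    out≢g : ∀ {x} → Out x → ∀ t → x ≢ g t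
    out≢g o t eq with g t | h t | choice t
    ... | _ | _ | swapped _ = proj₂ o eq
    ... | _ | _ | kept _ = proj₁ o eq
    out≢h : ∀ {x} → Out x → ∀ t → x ≢ h t
    out≢h o t eq with g t | h t | choice t
    ... | _ | _ | swapped _ = proj₁ o eq
    ... | _ | _ | kept _ = proj₂ o eq

    S : List (Fin n)
    S = r ∷ tabulate g
    size : ∣ fromList S ∣ ≡ suc j
    size = trans (∣fromList∣ (All.tabulate⁺ (out≢g r-out) ∷ Unique.tabulate⁺ g-injective)) (cong suc (length-tabulate g))
    r∈ : r ∈ₛ fromList S
    r∈ = ∈-subset⁺ (_∈? S) (here refl)
    g∈ : ∀ t → g t ∈ₛ fromList S
    g∈ t = ∈-subset⁺ (_∈? S) (there (∈-tabulate⁺ t))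
    u∈ : ∀ {t} → ¬ B t → u t ∈ₛ fromList S
    u∈ {t} ¬b with g t | h t | choice t | g∈ t
    ... | _ | _ | swapped b | _ = ⊥-elim (¬b b)
    ... | _ | _ | kept _ | m = m
    S⁻ : ∀ {x} → x ∈ₛ fromList S → x ≡ r ⊎ ∃ λ t → x ≡ g t
    S⁻ x∈ with ∈-subset⁻ (_∈? S) x∈
    ... | here eq = inj₁ eq
    ... | there x∈g = inj₂ (∈-tabulate⁻ x∈g)

    dom : Dominating G (fromList S)
    dom x with position x
    dom .(u t) | at-u t with g t | h t | choice t | g∈ t
    ... | _ | _ | swapped _ | m = inj₂ (v t , m , E-sym (uv-edge t))
    ... | _ | _ | kept _ | m = inj₁ m
    dom .(v t) | at-v t with g t | h t | choice t | g∈ t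
    ... | _ | _ | swapped _ | m = inj₁ m
    ... | _ | _ | kept _ | m = inj₂ (u t , m , uv-edge t)
    dom x | out o with x Fin.≟ s | out⇒pentagon o
    ... | yes refl | _ = inj₂ (r , r∈ , rs)
    -- The bases of an apex other than `s` are outside `B`, where `u t` was kept; `s` itself has
    -- lost `u a` and `u c` and is dominated by `r`.
    ... | no x≢s | t , _ , p = inj₂ (u t , u∈ (λ b → x≢s (s-apex b p)) , E-sym (ru p))

    priv : ∀ x → x ∈ₛ fromList S → ∃ λ y → ∀ z → z ∈ₛ fromList S → z ≡ y ⊎ E G y z → z ≡ x
    priv x x∈ with S⁻ x∈
    ... | inj₁ refl = s , λ z z∈ near → r-only (S⁻ z∈) near
      where
      r-only : ∀ {z} → z ≡ r ⊎ (∃ λ t → z ≡ g t) → z ≡ s ⊎ E G s z → z ≡ r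
      r-only (inj₁ eq) _ = eq
      r-only (inj₂ (t , refl)) (inj₁ eq) = ⊥-elim (out≢g s-out t (sym eq))
      r-only (inj₂ (t , refl)) (inj₂ e) with g t | h t | choice t
      ... | _ | _ | swapped _ = ⊥-elim (proj₁ (pentagon-neighbours q) e)
      ... | _ | _ | kept ¬b = ⊥-elim (¬b (s-sees e))
    ... | inj₂ (t , refl) = h t , λ z z∈ near → g-only (S⁻ z∈) near
      where
      g-only : ∀ {z} → z ≡ r ⊎ (∃ λ t → z ≡ g t) → z ≡ h t ⊎ E G (h t) z → z ≡ g t
      g-only (inj₁ refl) (inj₁ eq) = ⊥-elim (out≢h r-out t eq)
      g-only (inj₁ refl) (inj₂ e) with g t | h t | choice t
      ... | _ | _ | swapped b = ⊥-elim (r-misses b (E-sym e))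
      ... | _ | _ | kept _ = ⊥-elim (proj₁ (pentagon-neighbours p) (E-sym e))
      g-only (inj₂ (t′ , refl)) near with g t | h t | choice t | g t′ | h t′ | choice t′ | near
      ... | _ | _ | swapped _ | _ | _ | swapped _ | inj₁ eq = ⊥-elim (u≢v (sym eq))
      ... | _ | _ | swapped b | _ | _ | kept ¬b | inj₁ eq = ⊥-elim (¬b (subst B (sym (u-inj eq)) b))
      ... | _ | _ | kept ¬b | _ | _ | swapped b | inj₁ eq = ⊥-elim (¬b (subst B (v-inj eq) b))
      ... | _ | _ | kept _ | _ | _ | kept _ | inj₁ eq = ⊥-elim (u≢v eq)
      ... | _ | _ | swapped _ | _ | _ | swapped _ | inj₂ e = cong v (sym (uv-edge⇒≡ e))
      ... | _ | _ | swapped _ | _ | _ | kept _ | inj₂ e = ⊥-elim (¬uu-edge e)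
      ... | _ | _ | kept ¬b | _ | _ | swapped b | inj₂ e = ⊥-elim (¬b (vv-closed b (E-sym e)))
      ... | _ | _ | kept _ | _ | _ | kept _ | inj₂ e = cong u (uv-edge⇒≡ (E-sym e))

-- Coordinates on m₁K₂ + m₂C₅

Coord : ℕ → ℕ → Set
Coord m₁ m₂ = (Fin m₁ × Fin 2) ⊎ (Fin m₂ × Fin 5)

suc₅ pred₅ : Fin 5 → Fin 5
suc₅ 0F = 1F
suc₅ 1F = 2F
suc₅ 2F = 3F
suc₅ 3F = 4F
suc₅ 4F = 0F
pred₅ 0F = 4F
pred₅ 1F = 0F
pred₅ 2F = 1F
pred₅ 3F = 2F
pred₅ 4F = 3F

flip₂ : Fin 2 → Fin 2
flip₂ 0F = 1F
flip₂ 1F = 0F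

N₂ : Fin 2 → List (Fin 2)
N₂ p = flip₂ p ∷ []

N₅ : Fin 5 → List (Fin 5)
N₅ p = suc₅ p ∷ pred₅ p ∷ []

-- Adjacency as an explicit list, so that matching on membership enumerates the neighbours.
neighbours : ∀ {m₁ m₂} → Coord m₁ m₂ → List (Coord m₁ m₂)
neighbours (inj₁ (c , p)) = map (λ q → inj₁ (c , q)) (N₂ p)
neighbours (inj₂ (c , p)) = map (λ q → inj₂ (c , q)) (N₅ p)

adj₅ : Fin 5 → Fin 5 → Bool
adj₅ p q = ⌊ toℕ q ℕ.≟ suc (toℕ p) % 5 ⌋ ∨ ⌊ toℕ p ℕ.≟ suc (toℕ q) % 5 ⌋

adjCoord : ∀ {m₁ m₂} → Coord m₁ m₂ → Coord m₁ m₂ → Bool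
adjCoord (inj₁ (c , p)) (inj₁ (d , q)) = ⌊ c Fin.≟ d ⌋ ∧ not ⌊ p Fin.≟ q ⌋
adjCoord (inj₂ (c , p)) (inj₂ (d , q)) = ⌊ c Fin.≟ d ⌋ ∧ adj₅ p q
adjCoord (inj₁ _) (inj₂ _) = false
adjCoord (inj₂ _) (inj₁ _) = false

module _ {m₁ m₂ : ℕ} where

  coord : Fin (m₁ * 2 + m₂ * 5) → Coord m₁ m₂
  coord i = Sum.map (remQuot {m₁} 2) (remQuot {m₂} 5) (splitAt (m₁ * 2) i)

  uncoord : Coord m₁ m₂ → Fin (m₁ * 2 + m₂ * 5)
  uncoord x = join (m₁ * 2) (m₂ * 5) (Sum.map (uncurry combine) (uncurry combine) x)

  coord-uncoord : ∀ x → coord (uncoord x) ≡ x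
  coord-uncoord (inj₁ (c , p)) rewrite Fin.splitAt-↑ˡ (m₁ * 2) (combine c p) (m₂ * 5) =
    cong inj₁ (Fin.remQuot-combine c p)
  coord-uncoord (inj₂ (c , p)) rewrite Fin.splitAt-↑ʳ (m₁ * 2) (m₂ * 5) (combine c p) =
    cong inj₂ (Fin.remQuot-combine c p)

  uncoord-coord : ∀ i → uncoord (coord i) ≡ i
  uncoord-coord i = trans (cong (join (m₁ * 2) (m₂ * 5)) (collapse (splitAt (m₁ * 2) i)))
                          (Fin.join-splitAt (m₁ * 2) (m₂ * 5) i)
    where
    collapse : ∀ y → Sum.map (uncurry combine) (uncurry combine) (Sum.map (remQuot {m₁} 2) (remQuot {m₂} 5) y) ≡ y
    collapse (inj₁ a) = cong inj₁ (Fin.combine-remQuot {m₁} 2 a)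
    collapse (inj₂ b) = cong inj₂ (Fin.combine-remQuot {m₂} 5 b)

  K2C5adj≡adjCoord : ∀ i j → K2C5adj m₁ m₂ i j ≡ adjCoord (coord i) (coord j)
  K2C5adj≡adjCoord i j with splitAt (m₁ * 2) i | splitAt (m₁ * 2) j
  ... | inj₁ _ | inj₁ _ = refl
  ... | inj₁ _ | inj₂ _ = refl
  ... | inj₂ _ | inj₁ _ = refl
  ... | inj₂ _ | inj₂ _ = refl

  adj₂⇒flip : ∀ p q → not ⌊ p Fin.≟ q ⌋ ≡ true → q ≡ flip₂ p
  adj₂⇒flip = from-yes (Fin.all? λ p → Fin.all? λ q →
    (not ⌊ p Fin.≟ q ⌋ Bool.≟ true) →-dec (q Fin.≟ flip₂ p))

  adj₅⇒suc⊎pred : ∀ p q → adj₅ p q ≡ true → q ≡ suc₅ p ⊎ q ≡ pred₅ p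
  adj₅⇒suc⊎pred = from-yes (Fin.all? λ p → Fin.all? λ q →
    (adj₅ p q Bool.≟ true) →-dec ((q Fin.≟ suc₅ p) ⊎-dec (q Fin.≟ pred₅ p)))

  adjCoord⇒∈ : ∀ (x y : Coord m₁ m₂) → adjCoord x y ≡ true → y ∈ neighbours x
  adjCoord⇒∈ (inj₁ (c , p)) (inj₁ (d , q)) eq with c Fin.≟ d
  ... | yes refl = here (cong (λ r → inj₁ (c , r)) (adj₂⇒flip p q eq))
  adjCoord⇒∈ (inj₂ (c , p)) (inj₂ (d , q)) eq with c Fin.≟ d
  ... | yes refl with adj₅⇒suc⊎pred p q eq
  ...   | inj₁ refl = here refl
  ...   | inj₂ refl = there (here refl)

  ∈⇒adjCoord : ∀ (x y : Coord m₁ m₂) → y ∈ neighbours x → adjCoord x y ≡ true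
  ∈⇒adjCoord (inj₁ (c , p)) _ (here refl) with c Fin.≟ c
  ... | no ne = ⊥-elim (ne refl)
  ... | yes _ = from-yes (Fin.all? λ p → not ⌊ p Fin.≟ flip₂ p ⌋ Bool.≟ true) p
  ∈⇒adjCoord (inj₂ (c , p)) _ (here refl) with c Fin.≟ c
  ... | no ne = ⊥-elim (ne refl)
  ... | yes _ = from-yes (Fin.all? λ p → adj₅ p (suc₅ p) Bool.≟ true) p
  ∈⇒adjCoord (inj₂ (c , p)) _ (there (here refl)) with c Fin.≟ c
  ... | no ne = ⊥-elim (ne refl)
  ... | yes _ = from-yes (Fin.all? λ p → adj₅ p (pred₅ p) Bool.≟ true) p

-- An isomorphism with m₁K₂ + m₂C₅ whose preservation and reflection of edges are separate fields;
-- both directions of the theorem pass through it.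
record Decomposition {n} (G : Graph n) (m₁ m₂ : ℕ) : Set where
  field
    vertex            : Coord m₁ m₂ → Fin n
    coordinate        : Fin n → Coord m₁ m₂
    vertex-coordinate : ∀ x → vertex (coordinate x) ≡ x
    coordinate-vertex : ∀ x → coordinate (vertex x) ≡ x
    adjacent          : ∀ x {y} → y ∈ neighbours x → E G (vertex x) (vertex y)
    neighbour         : ∀ x {z} → E G (vertex x) z → ∃ λ y → y ∈ neighbours x × z ≡ vertex y

true-cong : ∀ {a b} → (a ≡ true → b ≡ true) → (b ≡ true → a ≡ true) → a ≡ b
true-cong {true} f g = sym (f refl)
true-cong {false} {false} f g = refl
true-cong {false} {true} f g = g refl

module _ {n} (G : Graph n) {m₁ m₂ : ℕ} where
  open Graph G using (adj)

  decomposition⇒isomorphic : Decomposition G m₁ m₂ → Isomorphic G (K2C5adj m₁ m₂)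
  decomposition⇒isomorphic d = mk↔ₛ′ (uncoord ∘ coordinate) (vertex ∘ coord)
      (λ i → trans (cong uncoord (coordinate-vertex (coord i))) (uncoord-coord {m₁} {m₂} i))
      (λ x → trans (cong vertex (coord-uncoord (coordinate x))) (vertex-coordinate x))
    , λ x y → trans (true-cong (to x y) (from x y)) (sym (trans (K2C5adj≡adjCoord {m₁} {m₂} _ _)
        (cong₂ adjCoord (coord-uncoord (coordinate x)) (coord-uncoord (coordinate y)))))
    where
    open Decomposition d
    to : ∀ x y → adj x y ≡ true → adjCoord (coordinate x) (coordinate y) ≡ true
    to x y e with neighbour (coordinate x) (subst (λ z → E G z y) (sym (vertex-coordinate x)) e)
    ... | z , z∈ , refl = ∈⇒adjCoord (coordinate x) _ (subst (_∈ neighbours (coordinate x)) (sym (coordinate-vertex z)) z∈)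
    from : ∀ x y → adjCoord (coordinate x) (coordinate y) ≡ true → adj x y ≡ true
    from x y eq = subst₂ (E G) (vertex-coordinate x) (vertex-coordinate y)
      (adjacent (coordinate x) (adjCoord⇒∈ (coordinate x) (coordinate y) eq))

  isomorphic⇒decomposition : Isomorphic G (K2C5adj m₁ m₂) → Decomposition G m₁ m₂
  isomorphic⇒decomposition (f , iso) = record
    { vertex = vertex
    ; coordinate = coordinate
    ; vertex-coordinate = vertex-coordinate
    ; coordinate-vertex = coordinate-vertex
    ; adjacent = λ x {y} y∈ → trans (adj-vertex x y) (∈⇒adjCoord x y y∈)
    ; neighbour = λ x {z} e → coordinate z
        , adjCoord⇒∈ x (coordinate z)
            (trans (sym (adj-vertex x (coordinate z))) (trans (cong (adj (vertex x)) (vertex-coordinate z)) e))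
        , sym (vertex-coordinate z)
    }
    where
    vertex : Coord m₁ m₂ → Fin n
    vertex = Inverse.from f ∘ uncoord
    coordinate : Fin n → Coord m₁ m₂
    coordinate = coord ∘ Inverse.to f
    vertex-coordinate : ∀ x → vertex (coordinate x) ≡ x
    vertex-coordinate x = trans (cong (Inverse.from f) (uncoord-coord {m₁} {m₂} (Inverse.to f x))) (Inverse.strictlyInverseʳ f x)
    coordinate-vertex : ∀ x → coordinate (vertex x) ≡ x
    coordinate-vertex x = trans (cong coord (Inverse.strictlyInverseˡ f (uncoord x))) (coord-uncoord x)
    adj-vertex : ∀ x y → adj (vertex x) (vertex y) ≡ adjCoord x y
    adj-vertex x y = trans (iso (vertex x) (vertex y)) (trans (K2C5adj≡adjCoord {m₁} {m₂} _ _)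
      (cong₂ adjCoord (coordinate-vertex x) (coordinate-vertex y)))

-- Assembling the K₂ and C₅ components

module PentagonDecomposition {n} (G : Graph n) (cactus : Cactus G) (△-free : TriangleFree G) {j} (corona : Corona G j)
  (Γ≤j : ∀ D → MinimalDominating G D → ∣ D ∣ ≤ j) where
  open Domination G
  open Corona corona
  open PentagonStructure G cactus △-free corona Γ≤j

  -- An outside neighbour is the apex of some pentagon and, among the pairs, sees only `u` at its
  -- two bases; so `t` is one of these bases.
  u-neighbour : ∀ {t z} → E G (u t) z → z ≡ v t ⊎ ∃ (Pentagon z t)
  u-neighbour {t} {z} e with position z
  ... | at-u _ = ⊥-elim (¬uu-edge e)
  ... | at-v _ = inj₁ (cong v (sym (uv-edge⇒≡ e)))
  ... | out o with out⇒pentagon o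
  ...   | i , l , p with proj₂ (pentagon-neighbours p) (E-sym e)
  ...     | inj₁ refl = inj₂ (l , p)
  ...     | inj₂ refl = inj₂ (i , pentagon-sym p)

  v-neighbour : ∀ {t z} → E G (v t) z → z ≡ u t ⊎ ∃ λ t′ → z ≡ v t′ × E G (v t) (v t′)
  v-neighbour {t} {z} e with position z
  ... | at-u _ = inj₁ (cong u (uv-edge⇒≡ (E-sym e)))
  ... | at-v t′ = inj₂ (t′ , refl , e)
  ... | out o = ⊥-elim (proj₁ (pentagon-neighbours (proj₂ (proj₂ (out⇒pentagon o)))) (E-sym e))

  apex-neighbour : ∀ {r i l z} → Pentagon r i l → E G r z → z ≡ u i ⊎ z ≡ u l
  apex-neighbour {z = z} p e with position z
  ... | at-u _ = Sum.map (cong u) (cong u) (proj₂ (pentagon-neighbours p) e)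
  ... | at-v _ = ⊥-elim (proj₁ (pentagon-neighbours p) e)
  ... | out o = ⊥-elim (out-independent (Pentagon.isOut p) o e)

  -- These pairs become the K₂ components. Any other pair has an edge `v t v l` and so is a base of
  -- a pentagon.
  Isolated : Fin j → Set
  Isolated t = ∀ l → ¬ E G (v t) (v l)

  isolated? : Decidable Isolated
  isolated? t = Fin.all? λ l → ¬? (E? (v t) (v l))

  out? : Decidable Out
  out? x with position x
  ... | at-u _ = no λ o → proj₁ o refl
  ... | at-v _ = no λ o → proj₂ o refl
  ... | out o = yes o

  edges : List (Fin j)
  edges = filter isolated? (allFin j)

  apexes : List (Fin n)
  apexes = filter out? (allFin n)

  m₁ m₂ : ℕ
  m₁ = length edges
  m₂ = length apexes

  K : Fin m₁ → Fin j
  K = lookup edges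

  K-isolated : ∀ c → Isolated (K c)
  K-isolated c = proj₂ (∈-filter⁻ isolated? {xs = allFin j} (∈-lookup c))

  apex : Fin m₂ → Fin n
  apex = lookup apexes

  apex-injective : ∀ {c d} → apex c ≡ apex d → c ≡ d
  apex-injective = lookup-injective (Unique.filter⁺ out? (Unique.allFin⁺ n))

  apex-out : ∀ c → Out (apex c)
  apex-out c = proj₂ (∈-filter⁻ out? {xs = allFin n} (∈-lookup c))

  apex-surjective : ∀ {x} → Out x → ∃ λ c → apex c ≡ x
  apex-surjective {x} o = Any.index x∈ , sym (Any.lookup-index x∈)
    where
    x∈ : x ∈ apexes
    x∈ = ∈-filter⁺ out? (∈-allFin x) o

  base : Fin m₂ → Bool → Fin j
  base c false = proj₁ (out⇒pentagon (apex-out c))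
  base c true = proj₁ (proj₂ (out⇒pentagon (apex-out c)))

  apex-pentagon : ∀ c s → Pentagon (apex c) (base c s) (base c (not s))
  apex-pentagon c false = proj₂ (proj₂ (out⇒pentagon (apex-out c)))
  apex-pentagon c true = pentagon-sym (apex-pentagon c false)

  -- A second numbering of the pairs, by component: a K₂, or a C₅ together with one of its two
  -- sides. `index` is a bijection from it onto the original numbers.
  Index : Set
  Index = Fin m₁ ⊎ (Fin m₂ × Bool)

  index : Index → Fin j
  index (inj₁ c) = K c
  index (inj₂ (c , s)) = base c s

  K≢base : ∀ c d s → K c ≢ base d s
  K≢base c d s eq = K-isolated c (base d (not s))
    (subst (λ t → E G (v t) (v (base d (not s)))) (sym eq) (Pentagon.vv (apex-pentagon d s)))

  base-injective : ∀ {c d s s′} → base c s ≡ base d s′ → (c , s) ≡ (d , s′)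
  base-injective {c} {d} {s} {s′} eq
    with apex-injective (proj₁ (pentagon-unique (apex-pentagon c s)
           (subst (λ t → Pentagon (apex d) t (base d (not s′))) (sym eq) (apex-pentagon d s′))))
  ... | refl with s Bool.≟ s′
  ...   | yes refl = refl
  ...   | no s≢s′ = ⊥-elim (vv⇒≢ (Pentagon.vv (apex-pentagon c s))
                      (trans eq (cong (base c) (Bool.¬-not (s≢s′ ∘ sym)))))

  index-injective : ∀ {x y} → index x ≡ index y → x ≡ y
  index-injective {inj₁ _} {inj₁ _} eq = cong inj₁ (lookup-injective (Unique.filter⁺ isolated? (Unique.allFin⁺ j)) eq)
  index-injective {inj₁ c} {inj₂ (d , s)} eq = ⊥-elim (K≢base c d s eq)
  index-injective {inj₂ (c , s)} {inj₁ d} eq = ⊥-elim (K≢base d c s (sym eq))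
  index-injective {inj₂ _} {inj₂ _} eq = cong inj₂ (base-injective eq)

  pentagon-base : ∀ {x i l} → Pentagon x i l → ∃₂ λ c s → base c s ≡ i
  pentagon-base {x} {i} p with apex-surjective (Pentagon.isOut p)
  ... | c , refl with proj₂ (pentagon-neighbours (apex-pentagon c false)) (Pentagon.ru p)
  ...   | inj₁ eq = c , false , sym eq
  ...   | inj₂ eq = c , true , sym eq

  index-surjective : ∀ t → ∃ λ x → index x ≡ t
  index-surjective t with Fin.any? (λ l → E? (v t) (v l))
  ... | yes (l , e) = let c , s , eq = pentagon-base (proj₁ (proj₂ (vv⇒pentagon e))) in inj₂ (c , s) , eq
  ... | no none = inj₁ (Any.index t∈) , sym (Any.lookup-index t∈)
    where
    t∈ : t ∈ edges
    t∈ = ∈-filter⁺ isolated? (∈-allFin t) (λ l e → none (l , e))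

  -- Coordinates regrouped by role: outside vertex, `u`, or `v`. Injectivity of the placement is
  -- thus split along the same lines as `Position`. Around a C₅ the roles are apex, foot, top, top,
  -- foot.
  data Slot : Set where
    apexₛ     : Fin m₂ → Slot
    footₛ topₛ : Index → Slot

  slot : Coord m₁ m₂ → Slot
  slot (inj₁ (c , 0F)) = footₛ (inj₁ c)
  slot (inj₁ (c , 1F)) = topₛ (inj₁ c)
  slot (inj₂ (c , 0F)) = apexₛ c
  slot (inj₂ (c , 1F)) = footₛ (inj₂ (c , false))
  slot (inj₂ (c , 2F)) = topₛ (inj₂ (c , false))
  slot (inj₂ (c , 3F)) = topₛ (inj₂ (c , true))
  slot (inj₂ (c , 4F)) = footₛ (inj₂ (c , true))

  unslot : Slot → Coord m₁ m₂
  unslot (apexₛ c) = inj₂ (c , 0F)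
  unslot (footₛ (inj₁ c)) = inj₁ (c , 0F)
  unslot (topₛ (inj₁ c)) = inj₁ (c , 1F)
  unslot (footₛ (inj₂ (c , false))) = inj₂ (c , 1F)
  unslot (topₛ (inj₂ (c , false))) = inj₂ (c , 2F)
  unslot (topₛ (inj₂ (c , true))) = inj₂ (c , 3F)
  unslot (footₛ (inj₂ (c , true))) = inj₂ (c , 4F)

  unslot-slot : ∀ x → unslot (slot x) ≡ x
  unslot-slot (inj₁ (c , 0F)) = refl
  unslot-slot (inj₁ (c , 1F)) = refl
  unslot-slot (inj₂ (c , 0F)) = refl
  unslot-slot (inj₂ (c , 1F)) = refl
  unslot-slot (inj₂ (c , 2F)) = refl
  unslot-slot (inj₂ (c , 3F)) = refl
  unslot-slot (inj₂ (c , 4F)) = refl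

  slot-unslot : ∀ x → slot (unslot x) ≡ x
  slot-unslot (apexₛ c) = refl
  slot-unslot (footₛ (inj₁ c)) = refl
  slot-unslot (topₛ (inj₁ c)) = refl
  slot-unslot (footₛ (inj₂ (c , false))) = refl
  slot-unslot (topₛ (inj₂ (c , false))) = refl
  slot-unslot (topₛ (inj₂ (c , true))) = refl
  slot-unslot (footₛ (inj₂ (c , true))) = refl

  place : Slot → Fin n
  place (apexₛ c) = apex c
  place (footₛ x) = u (index x)
  place (topₛ x) = v (index x)

  place-injective : ∀ {x y} → place x ≡ place y → x ≡ y
  place-injective {apexₛ _} {apexₛ _} eq = cong apexₛ (apex-injective eq)
  place-injective {apexₛ c} {footₛ _} eq = ⊥-elim (proj₁ (apex-out c) eq)
  place-injective {apexₛ c} {topₛ _} eq = ⊥-elim (proj₂ (apex-out c) eq)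
  place-injective {footₛ _} {apexₛ c} eq = ⊥-elim (proj₁ (apex-out c) (sym eq))
  place-injective {footₛ _} {footₛ _} eq = cong footₛ (index-injective (u-inj eq))
  place-injective {footₛ _} {topₛ _} eq = ⊥-elim (u≢v eq)
  place-injective {topₛ _} {apexₛ c} eq = ⊥-elim (proj₂ (apex-out c) (sym eq))
  place-injective {topₛ _} {footₛ _} eq = ⊥-elim (u≢v (sym eq))
  place-injective {topₛ _} {topₛ _} eq = cong topₛ (index-injective (v-inj eq))

  locate : ∀ x → ∃ λ y → place y ≡ x
  locate x with position x
  ... | at-u t = let y , eq = index-surjective t in footₛ y , cong u eq
  ... | at-v t = let y , eq = index-surjective t in topₛ y , cong v eq
  ... | out o = let c , eq = apex-surjective o in apexₛ c , eq

  vertex : Coord m₁ m₂ → Fin n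
  vertex = place ∘ slot

  adjacent : ∀ x {y} → y ∈ neighbours x → E G (vertex x) (vertex y)
  adjacent (inj₁ (c , 0F)) (here refl) = uv-edge _
  adjacent (inj₁ (c , 1F)) (here refl) = E-sym (uv-edge _)
  adjacent (inj₂ (c , 0F)) (here refl) = Pentagon.ru (apex-pentagon c false)
  adjacent (inj₂ (c , 0F)) (there (here refl)) = Pentagon.ru (apex-pentagon c true)
  adjacent (inj₂ (c , 1F)) (here refl) = uv-edge _
  adjacent (inj₂ (c , 1F)) (there (here refl)) = E-sym (Pentagon.ru (apex-pentagon c false))
  adjacent (inj₂ (c , 2F)) (here refl) = Pentagon.vv (apex-pentagon c false)
  adjacent (inj₂ (c , 2F)) (there (here refl)) = E-sym (uv-edge _)
  adjacent (inj₂ (c , 3F)) (here refl) = E-sym (uv-edge _)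
  adjacent (inj₂ (c , 3F)) (there (here refl)) = Pentagon.vv (apex-pentagon c true)
  adjacent (inj₂ (c , 4F)) (here refl) = E-sym (Pentagon.ru (apex-pentagon c true))
  adjacent (inj₂ (c , 4F)) (there (here refl)) = uv-edge _

  foot-neighbour : ∀ {c s z} → E G (u (base c s)) z → z ≡ v (base c s) ⊎ z ≡ apex c
  foot-neighbour {c} {s} e with u-neighbour e
  ... | inj₁ eq = inj₁ eq
  ... | inj₂ (_ , p) = inj₂ (proj₁ (pentagon-unique p (apex-pentagon c s)))

  top-neighbour : ∀ {c s z} → E G (v (base c s)) z → z ≡ u (base c s) ⊎ z ≡ v (base c (not s))
  top-neighbour {c} {s} e with v-neighbour e
  ... | inj₁ eq = inj₁ eq
  ... | inj₂ (_ , eq , e′) = inj₂ (trans eq (cong v (vv-unique e′ (Pentagon.vv (apex-pentagon c s)))))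

  neighbour : ∀ x {z} → E G (vertex x) z → ∃ λ y → y ∈ neighbours x × z ≡ vertex y
  neighbour (inj₁ (c , 0F)) e with u-neighbour e
  ... | inj₁ eq = _ , here refl , eq
  ... | inj₂ (l , p) = ⊥-elim (K-isolated c l (Pentagon.vv p))
  neighbour (inj₁ (c , 1F)) e with v-neighbour e
  ... | inj₁ eq = _ , here refl , eq
  ... | inj₂ (l , _ , e′) = ⊥-elim (K-isolated c l e′)
  neighbour (inj₂ (c , 0F)) e with apex-neighbour (apex-pentagon c false) e
  ... | inj₁ eq = _ , here refl , eq
  ... | inj₂ eq = _ , there (here refl) , eq
  neighbour (inj₂ (c , 1F)) e with foot-neighbour {c} {false} e
  ... | inj₁ eq = _ , here refl , eq
  ... | inj₂ eq = _ , there (here refl) , eq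
  neighbour (inj₂ (c , 2F)) e with top-neighbour {c} {false} e
  ... | inj₁ eq = _ , there (here refl) , eq
  ... | inj₂ eq = _ , here refl , eq
  neighbour (inj₂ (c , 3F)) e with top-neighbour {c} {true} e
  ... | inj₁ eq = _ , here refl , eq
  ... | inj₂ eq = _ , there (here refl) , eq
  neighbour (inj₂ (c , 4F)) e with foot-neighbour {c} {true} e
  ... | inj₁ eq = _ , there (here refl) , eq
  ... | inj₂ eq = _ , here refl , eq

  decomposition : Decomposition G m₁ m₂
  decomposition = record
    { vertex = vertex
    ; coordinate = unslot ∘ proj₁ ∘ locate
    ; vertex-coordinate = λ x → trans (cong place (slot-unslot (proj₁ (locate x)))) (proj₂ (locate x))
    ; coordinate-vertex = λ x → trans (cong unslot (place-injective (proj₂ (locate (vertex x))))) (unslot-slot x)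
    ; adjacent = adjacent
    ; neighbour = neighbour
    }

-- The values of Γ and Γpr on m₁K₂ + m₂C₅

-- The private-neighbour condition inside a single component, where `q ∷ N q` is a closed
-- neighbourhood.
PrivateIn : ∀ {k} → (Fin k → List (Fin k)) → Subset k → Set
PrivateIn N S = ∀ p → p ∈ₛ S → ∃ λ q → ∀ p′ → p′ ∈ₛ S → p′ ∈ q ∷ N q → p′ ≡ p

privateIn? : ∀ {k} (N : Fin k → List (Fin k)) → Decidable (PrivateIn N)
privateIn? N S = Fin.all? λ p → (p Subset.∈? S) →-dec (Fin.any? λ q → Fin.all? λ p′ →
  (p′ Subset.∈? S) →-dec ((p′ ∈? (q ∷ N q)) →-dec (p′ Fin.≟ p)))

-- This bound and the next are settled by inspecting all subsets, 4 of K₂ and 32 of C₅.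
K₂-private≤1 : ∀ S → PrivateIn N₂ S → ∣ S ∣ ≤ 1
K₂-private≤1 S priv = ℕ.≮⇒≥ λ lt →
  from-no (Subset.anySubset? λ S → privateIn? N₂ S ×-dec (1 ℕ.<? ∣ S ∣)) (S , priv , lt)

C₅-private≤2 : ∀ S → PrivateIn N₅ S → ∣ S ∣ ≤ 2
C₅-private≤2 S priv = ℕ.≮⇒≥ λ lt →
  from-no (Subset.anySubset? λ S → privateIn? N₅ S ×-dec (2 ℕ.<? ∣ S ∣)) (S , priv , lt)

length-concatMap-≤ : ∀ {A B : Set} (f : A → List B) {k} → (∀ x → length (f x) ≤ k) →
  ∀ xs → length (concatMap f xs) ≤ length xs * k
length-concatMap-≤ f le [] = z≤n
length-concatMap-≤ f le (x ∷ xs) rewrite length-++ (f x) {concatMap f xs} =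
  ℕ.+-mono-≤ (le x) (length-concatMap-≤ f le xs)

length-cartesianProduct : ∀ {A B : Set} (xs : List A) (ys : List B) →
  length (cartesianProduct xs ys) ≡ length xs * length ys
length-cartesianProduct [] ys = refl
length-cartesianProduct (x ∷ xs) ys = trans (length-++ (map (x ,_) ys))
  (cong₂ _+_ (length-map (x ,_) ys) (length-cartesianProduct xs ys))

module DecomposedGraph {n} {G : Graph n} {m₁ m₂} (decomposition : Decomposition G m₁ m₂) where
  open Domination G
  open Decomposition decomposition

  vertex-injective : ∀ {x y} → vertex x ≡ vertex y → x ≡ y
  vertex-injective {x} {y} eq = trans (sym (coordinate-vertex x)) (trans (cong coordinate eq) (coordinate-vertex y))

  by-coordinates : (P : Fin n → Set) → (∀ x → P (vertex x)) → ∀ x → P x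
  by-coordinates P h x = subst P (vertex-coordinate x) (h (coordinate x))

  edge₁ : ∀ {c p} → E G (vertex (inj₁ (c , p))) (vertex (inj₁ (c , flip₂ p)))
  edge₁ {c} {p} = adjacent (inj₁ (c , p)) (here refl)

  suc-edge : ∀ {c p} → E G (vertex (inj₂ (c , p))) (vertex (inj₂ (c , suc₅ p)))
  suc-edge {c} {p} = adjacent (inj₂ (c , p)) (here refl)

  pred-edge : ∀ {c p} → E G (vertex (inj₂ (c , p))) (vertex (inj₂ (c , pred₅ p)))
  pred-edge {c} {p} = adjacent (inj₂ (c , p)) (there (here refl))

  neighbour₁ : ∀ {c p z} → E G (vertex (inj₁ (c , p))) z → z ≡ vertex (inj₁ (c , flip₂ p))
  neighbour₁ e with neighbour _ e
  ... | _ , here refl , eq = eq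

  neighbour₂ : ∀ {c p z} → E G (vertex (inj₂ (c , p))) z →
    z ≡ vertex (inj₂ (c , suc₅ p)) ⊎ z ≡ vertex (inj₂ (c , pred₅ p))
  neighbour₂ e with neighbour _ e
  ... | _ , here refl , eq = inj₁ eq
  ... | _ , there (here refl) , eq = inj₂ eq

  module _ (D : Subset n) where

    in₁? : ∀ c → Decidable λ p → vertex (inj₁ (c , p)) ∈ₛ D
    in₁? c p = vertex (inj₁ (c , p)) Subset.∈? D

    in₂? : ∀ c → Decidable λ p → vertex (inj₂ (c , p)) ∈ₛ D
    in₂? c p = vertex (inj₂ (c , p)) Subset.∈? D

    trace₁ : Fin m₁ → Subset 2
    trace₁ c = subset (in₁? c)

    trace₂ : Fin m₂ → Subset 5
    trace₂ c = subset (in₂? c)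

    ∣D∣≤traces : ∀ {a b} → (∀ c → ∣ trace₁ c ∣ ≤ a) → (∀ c → ∣ trace₂ c ∣ ≤ b) → ∣ D ∣ ≤ m₁ * a + m₂ * b
    ∣D∣≤traces {a} {b} le₁ le₂ = begin
      ∣ D ∣                                ≤⟨ ∣∣≤length (λ {x} → by-coordinates (λ x → x ∈ₛ D → x ∈ left ++ right) cover x) ⟩
      length (left ++ right)               ≡⟨ length-++ left ⟩
      length left + length right           ≤⟨ ℕ.+-mono-≤
        (length-concatMap-≤ part₁ (λ c → bound _ (trace₁ c) (le₁ c)) (allFin m₁)) (length-concatMap-≤ part₂ (λ c → bound _ (trace₂ c) (le₂ c)) (allFin m₂)) ⟩
      length (allFin m₁) * a + length (allFin m₂) * b
        ≡⟨ cong₂ (λ k l → k * a + l * b) (length-tabulate {n = m₁} id) (length-tabulate {n = m₂} id) ⟩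
      m₁ * a + m₂ * b                      ∎
      where
      open ℕ.≤-Reasoning
      part₁ : Fin m₁ → List (Fin n)
      part₁ c = map (λ p → vertex (inj₁ (c , p))) (elements (trace₁ c))
      part₂ : Fin m₂ → List (Fin n)
      part₂ c = map (λ p → vertex (inj₂ (c , p))) (elements (trace₂ c))
      left right : List (Fin n)
      left = concatMap part₁ (allFin m₁)
      right = concatMap part₂ (allFin m₂)
      bound : ∀ {k e} (f : Fin k → Fin n) (S : Subset k) → ∣ S ∣ ≤ e → length (map f (elements S)) ≤ e
      bound f S le rewrite length-map f (elements S) | length-elements S = le
      cover : ∀ x → vertex x ∈ₛ D → vertex x ∈ left ++ right
      cover (inj₁ (c , p)) x∈ = ∈-++⁺ˡ (∈-concatMap⁺ part₁
        (lose (∈-allFin c) (∈-map⁺ _ (∈-elements⁺ (∈-subset⁺ (in₁? c) x∈)))))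
      cover (inj₂ (c , p)) x∈ = ∈-++⁺ʳ left (∈-concatMap⁺ part₂
        (lose (∈-allFin c) (∈-map⁺ _ (∈-elements⁺ (∈-subset⁺ (in₂? c) x∈)))))

  -- A private neighbour equals or sees its vertex, hence lies in the same component; so every trace
  -- satisfies `PrivateIn`.
  Γ≤ : ∀ D → MinimalDominating G D → ∣ D ∣ ≤ m₁ * 1 + m₂ * 2
  Γ≤ D minDom = ∣D∣≤traces D (λ c → K₂-private≤1 _ (priv₁ c)) (λ c → C₅-private≤2 _ (priv₂ c))
    where
    private-coordinate : ∀ x → vertex x ∈ₛ D → ∃ λ y → y ∈ x ∷ neighbours x ×
      (∀ z → vertex z ∈ₛ D → z ∈ y ∷ neighbours y → z ≡ x)
    private-coordinate x x∈ with minimal⇒private-neighbours minDom (vertex x) x∈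
    ... | y , near , only with near-coordinate near
      where
      near-coordinate : ∀ {y} → y ≡ vertex x ⊎ E G y (vertex x) → ∃ λ y′ → y′ ∈ x ∷ neighbours x × y ≡ vertex y′
      near-coordinate (inj₁ eq) = x , here refl , eq
      near-coordinate (inj₂ e) with neighbour x (E-sym e)
      ... | y′ , y′∈ , eq = y′ , there y′∈ , eq
    ... | y′ , y′∈ , refl = y′ , y′∈ , λ where
      z z∈ (here refl) → vertex-injective (only _ z∈ (inj₁ refl))
      z z∈ (there near′) → vertex-injective (only _ z∈ (inj₂ (adjacent y′ near′)))
    priv₁ : ∀ c → PrivateIn N₂ (trace₁ D c)
    priv₁ c p p∈ with private-coordinate (inj₁ (c , p)) (∈-subset⁻ (in₁? D c) p∈)
    ... | y , y∈ , only with ∈-map⁻ (λ q → inj₁ (c , q)) {xs = p ∷ N₂ p} y∈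
    ... | q , _ , refl = q , λ p′ p′∈ near → cong-inj₁ (only _ (∈-subset⁻ (in₁? D c) p′∈) (∈-map⁺ (λ q → inj₁ (c , q)) {xs = q ∷ N₂ q} near))
      where
      cong-inj₁ : ∀ {p q : Fin 2} → _≡_ {A = Coord m₁ m₂} (inj₁ (c , p)) (inj₁ (c , q)) → p ≡ q
      cong-inj₁ refl = refl
    priv₂ : ∀ c → PrivateIn N₅ (trace₂ D c)
    priv₂ c p p∈ with private-coordinate (inj₂ (c , p)) (∈-subset⁻ (in₂? D c) p∈)
    ... | y , y∈ , only with ∈-map⁻ (λ q → inj₂ (c , q)) {xs = p ∷ N₅ p} y∈
    ... | q , _ , refl = q , λ p′ p′∈ near → cong-inj₂ (only _ (∈-subset⁻ (in₂? D c) p′∈) (∈-map⁺ (λ q → inj₂ (c , q)) {xs = q ∷ N₅ q} near))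
      where
      cong-inj₂ : ∀ {p q : Fin 5} → _≡_ {A = Coord m₁ m₂} (inj₂ (c , p)) (inj₂ (c , q)) → p ≡ q
      cong-inj₂ refl = refl

  module Matched {D : Subset n} (matching : HasPerfectMatching G D) where

    m : Fin n → Fin n
    m = proj₁ matching

    matched₁ : ∀ {c p} → vertex (inj₁ (c , p)) ∈ₛ D → vertex (inj₁ (c , flip₂ p)) ∈ₛ D
    matched₁ x∈ with proj₂ matching _ x∈
    ... | m∈ , e , _ = subst (_∈ₛ D) (neighbour₁ e) m∈

    module _ (c : Fin m₂) where

      C : Fin 5 → Fin n
      C p = vertex (inj₂ (c , p))

      M : Fin 5 → Fin 5 → Set
      M p q = m (C p) ≡ C q × m (C q) ≡ C p × C q ∈ₛ D

      clash : ∀ {p q r} → m (C p) ≡ C q → m (C p) ≡ C r → q ≢ r → ⊥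
      clash eq eq′ q≢r with vertex-injective (trans (sym eq) eq′)
      ... | refl = q≢r refl

      matched₂ : ∀ p → C p ∈ₛ D → M p (suc₅ p) ⊎ M p (pred₅ p)
      matched₂ p x∈ with proj₂ matching _ x∈
      ... | m∈ , e , inv with neighbour₂ e
      ... | inj₁ eq = inj₁ (eq , trans (cong m (sym eq)) inv , subst (_∈ₛ D) eq m∈)
      ... | inj₂ eq = inj₂ (eq , trans (cong m (sym eq)) inv , subst (_∈ₛ D) eq m∈)

      -- Five is odd: the partner of `0F` forces further partners around the cycle until two of them
      -- collide.
      not-full : ¬ (∀ p → C p ∈ₛ D)
      not-full full with matched₂ 0F (full 0F)
      not-full full | inj₁ (m0 , m1 , _) with matched₂ 2F (full 2F)
      ... | inj₂ (_ , m1′ , _) = clash m1 m1′ λ ()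
      ... | inj₁ (_ , m3 , _) with matched₂ 4F (full 4F)
      ...   | inj₁ (_ , m0′ , _) = clash m0 m0′ λ ()
      ...   | inj₂ (_ , m3′ , _) = clash m3 m3′ λ ()
      not-full full | inj₂ (m0 , m4 , _) with matched₂ 1F (full 1F)
      ... | inj₂ (_ , m0′ , _) = clash m0 m0′ λ ()
      ... | inj₁ (_ , m2 , _) with matched₂ 3F (full 3F)
      ...   | inj₁ (_ , m4′ , _) = clash m4 m4′ λ ()
      ...   | inj₂ (_ , m2′ , _) = clash m2 m2′ λ ()

      -- Some neighbour of `4F` is in `D`, say `0F`; its partner must be `1F`. Dominating `3F` then
      -- takes `3F`, whose partner is `2F`, or `2F`, whose partner is `3F` because `1F` is taken.
      -- The case of `3F` is symmetric.
      first-four : Dominating G D → ¬ C 4F ∈ₛ D → ∀ p → p ≢ 4F → C p ∈ₛ D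
      first-four dom ¬4 = four (near 4F)
        where
        near : ∀ p → C p ∈ₛ D ⊎ C (suc₅ p) ∈ₛ D ⊎ C (pred₅ p) ∈ₛ D
        near p with dom (C p)
        ... | inj₁ p∈ = inj₁ p∈
        ... | inj₂ (_ , z∈ , e) with neighbour₂ (E-sym e)
        ...   | inj₁ refl = inj₂ (inj₁ z∈)
        ...   | inj₂ refl = inj₂ (inj₂ z∈)
        collect : C 0F ∈ₛ D → C 1F ∈ₛ D → C 2F ∈ₛ D → C 3F ∈ₛ D → ∀ p → p ≢ 4F → C p ∈ₛ D
        collect a b c d 0F _ = a
        collect a b c d 1F _ = b
        collect a b c d 2F _ = c
        collect a b c d 3F _ = d
        collect a b c d 4F ne = ⊥-elim (ne refl)
        zero-mate : C 0F ∈ₛ D → M 0F 1F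
        zero-mate x∈ with matched₂ 0F x∈
        ... | inj₁ mate = mate
        ... | inj₂ (_ , _ , 4∈) = ⊥-elim (¬4 4∈)
        three-mate : C 3F ∈ₛ D → M 3F 2F
        three-mate x∈ with matched₂ 3F x∈
        ... | inj₁ (_ , _ , 4∈) = ⊥-elim (¬4 4∈)
        ... | inj₂ mate = mate
        four : C 4F ∈ₛ D ⊎ C 0F ∈ₛ D ⊎ C 3F ∈ₛ D → ∀ p → p ≢ 4F → C p ∈ₛ D
        four (inj₁ 4∈) = ⊥-elim (¬4 4∈)
        four (inj₂ (inj₁ 0∈)) with zero-mate 0∈ | near 3F
        ... | _ , _ , 1∈ | inj₁ 3∈ = collect 0∈ 1∈ (proj₂ (proj₂ (three-mate 3∈))) 3∈
        ... | _ | inj₂ (inj₁ 4∈) = ⊥-elim (¬4 4∈)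
        ... | _ , m1 , 1∈ | inj₂ (inj₂ 2∈) with matched₂ 2F 2∈
        ...   | inj₁ (_ , _ , 3∈) = collect 0∈ 1∈ 2∈ 3∈
        ...   | inj₂ (_ , m1′ , _) = ⊥-elim (clash m1 m1′ λ ())
        four (inj₂ (inj₂ 3∈)) with three-mate 3∈ | near 0F
        ... | _ , _ , 2∈ | inj₁ 0∈ = collect 0∈ (proj₂ (proj₂ (zero-mate 0∈))) 2∈ 3∈
        ... | _ | inj₂ (inj₂ 4∈) = ⊥-elim (¬4 4∈)
        ... | _ , m2 , 2∈ | inj₂ (inj₁ 1∈) with matched₂ 1F 1∈
        ...   | inj₁ (_ , m2′ , _) = ⊥-elim (clash m2 m2′ λ ())
        ...   | inj₂ (_ , _ , 0∈) = collect 0∈ 1∈ 2∈ 3∈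

  -- Partners stay within a component, so parity forces `D` to miss a vertex of every C₅.
  Γpr≤ : ∀ D → MinimalPairedDominating G D → ∣ D ∣ ≤ m₁ * 2 + m₂ * 4
  Γpr≤ D ((dom , matching) , _) = ∣D∣≤traces D (λ c → Subset.∣p∣≤n (trace₁ D c)) λ c →
    ℕ.≤-pred (Subset.p⊂q⇒∣p∣<∣q∣ {q = ⊤} (Subset.⊆⊤ , missing c))
    where
    missing : ∀ c → ∃ λ p → p ∈ₛ ⊤ × ¬ p ∈ₛ trace₂ D c
    missing c with Fin.¬∀⟶∃¬ 5 _ (in₂? D c) (Matched.not-full matching c)
    ... | p , p∉ = p , Subset.∈⊤ , λ p∈ → p∉ (∈-subset⁻ (in₂? D c) p∈)

  module Block (ks : List (Fin 2)) (ps : List (Fin 5)) where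

    Selected : Coord m₁ m₂ → Set
    Selected (inj₁ (_ , p)) = p ∈ ks
    Selected (inj₂ (_ , p)) = p ∈ ps

    coords : List (Coord m₁ m₂)
    coords = map inj₁ (cartesianProduct (allFin m₁) ks) ++ map inj₂ (cartesianProduct (allFin m₂) ps)

    block : List (Fin n)
    block = map vertex coords

    ∈-block⁺ : ∀ x → Selected x → vertex x ∈ block
    ∈-block⁺ (inj₁ (c , p)) p∈ = ∈-map⁺ vertex (∈-++⁺ˡ (∈-map⁺ inj₁ (∈-cartesianProduct⁺ (∈-allFin c) p∈)))
    ∈-block⁺ (inj₂ (c , p)) p∈ = ∈-map⁺ vertex
      (∈-++⁺ʳ (map inj₁ (cartesianProduct (allFin m₁) ks)) (∈-map⁺ inj₂ (∈-cartesianProduct⁺ (∈-allFin c) p∈)))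

    ∈-block⁻ : ∀ {z} → z ∈ block → ∃ λ x → Selected x × z ≡ vertex x
    ∈-block⁻ z∈ with ∈-map⁻ vertex z∈
    ... | x , x∈ , eq with ∈-++⁻ (map inj₁ (cartesianProduct (allFin m₁) ks)) x∈
    ... | inj₁ x∈₁ with ∈-map⁻ inj₁ x∈₁
    ...   | _ , cp∈ , refl = x , proj₂ (∈-cartesianProduct⁻ (allFin m₁) ks cp∈) , eq
    ∈-block⁻ z∈ | x , x∈ , eq | inj₂ x∈₂ with ∈-map⁻ inj₂ x∈₂
    ...   | _ , cp∈ , refl = x , proj₂ (∈-cartesianProduct⁻ (allFin m₂) ps cp∈) , eq

    block⇒selected : ∀ x → vertex x ∈ block → Selected x
    block⇒selected x x∈ with ∈-block⁻ x∈
    ... | y , sel , eq with vertex-injective eq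
    ... | refl = sel

    block-unique : Unique ks → Unique ps → Unique block
    block-unique uk up = Unique.map⁺ vertex-injective (Unique.++⁺
      (Unique.map⁺ (λ { refl → refl }) (Unique.cartesianProduct⁺ (Unique.allFin⁺ m₁) uk))
      (Unique.map⁺ (λ { refl → refl }) (Unique.cartesianProduct⁺ (Unique.allFin⁺ m₂) up))
      λ (x∈ , y∈) → disjoint x∈ y∈)
      where
      disjoint : ∀ {x} {xs : List (Fin m₁ × Fin 2)} {ys : List (Fin m₂ × Fin 5)} →
        x ∈ map inj₁ xs → x ∈ map inj₂ ys → ⊥
      disjoint x∈ y∈ with ∈-map⁻ inj₁ x∈ | ∈-map⁻ inj₂ y∈
      ... | _ , _ , refl | _ , _ , ()

    length-block : length block ≡ m₁ * length ks + m₂ * length ps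
    length-block = begin
      length block                  ≡⟨ length-map vertex coords ⟩
      length coords                 ≡⟨ length-++ (map inj₁ (cartesianProduct (allFin m₁) ks)) ⟩
      length (map inj₁ (cartesianProduct (allFin m₁) ks)) + length (map inj₂ (cartesianProduct (allFin m₂) ps))
        ≡⟨ cong₂ _+_ (trans (length-map inj₁ (cartesianProduct (allFin m₁) ks)) (size m₁ ks))
                     (trans (length-map inj₂ (cartesianProduct (allFin m₂) ps)) (size m₂ ps)) ⟩
      m₁ * length ks + m₂ * length ps ∎
      where
      open ≡-Reasoning
      size : ∀ {A : Set} k (xs : List A) → length (cartesianProduct (allFin k) xs) ≡ k * length xs
      size k xs = trans (length-cartesianProduct (allFin k) xs) (cong (_* length xs) (length-tabulate {n = k} id))

  Γ-attained : ∃ λ D → MinimalDominating G D × ∣ D ∣ ≡ m₁ * 1 + m₂ * 2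
  Γ-attained = fromList block , independent-dominating⇒minimal (independent unique block-apart)
      (by-coordinates (λ x → x ∈ block ⊎ ∃ λ z → z ∈ block × E G x z) dom)
    , trans (∣fromList∣ unique) length-block
    where
    -- One end of each K₂ and two vertices at distance two in each C₅: a maximal independent set.
    open Block [ 0F ] (0F ∷ 2F ∷ [])
    unique : Unique block
    unique = block-unique ([] ∷ []) (((λ ()) ∷ []) ∷ [] ∷ [])
    independent : ∀ {xs} → Unique xs → (∀ {x y} → x ∈ xs → y ∈ xs → ¬ E G x y) → AllPairs Apart xs
    independent [] _ = []
    independent (x# ∷ u) na = All.tabulate (λ y∈ → All.lookup x# y∈ , na (here refl) (there y∈))
      ∷ independent u (λ x∈ y∈ → na (there x∈) (there y∈))
    selected-apart : ∀ x {y} → Selected x → y ∈ neighbours x → ¬ Selected y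
    selected-apart (inj₁ _) (here refl) (here refl) (here ())
    selected-apart (inj₂ _) (here refl) (here refl) (there (here ()))
    selected-apart (inj₂ _) (here refl) (there (here refl)) (there (here ()))
    selected-apart (inj₂ _) (there (here refl)) (here refl) (there (here ()))
    selected-apart (inj₂ _) (there (here refl)) (there (here refl)) (there (here ()))
    block-apart : ∀ {x y} → x ∈ block → y ∈ block → ¬ E G x y
    block-apart x∈ y∈ e with ∈-block⁻ x∈
    ... | x , sel , refl with neighbour x e
    ... | y , y∈N , refl = selected-apart x sel y∈N (block⇒selected y y∈)
    dom : ∀ x → vertex x ∈ block ⊎ ∃ λ z → z ∈ block × E G (vertex x) z
    dom (inj₁ (c , 0F)) = inj₁ (∈-block⁺ (inj₁ (c , 0F)) (here refl))
    dom (inj₁ (c , 1F)) = inj₂ (_ , ∈-block⁺ (inj₁ (c , 0F)) (here refl) , edge₁)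
    dom (inj₂ (c , 0F)) = inj₁ (∈-block⁺ (inj₂ (c , 0F)) (here refl))
    dom (inj₂ (c , 1F)) = inj₂ (_ , ∈-block⁺ (inj₂ (c , 0F)) (here refl) , pred-edge)
    dom (inj₂ (c , 2F)) = inj₁ (∈-block⁺ (inj₂ (c , 2F)) (there (here refl)))
    dom (inj₂ (c , 3F)) = inj₂ (_ , ∈-block⁺ (inj₂ (c , 2F)) (there (here refl)) , pred-edge)
    dom (inj₂ (c , 4F)) = inj₂ (_ , ∈-block⁺ (inj₂ (c , 0F)) (here refl) , suc-edge)

  Γpr-attained : ∃ λ D → MinimalPairedDominating G D × ∣ D ∣ ≡ m₁ * 2 + m₂ * 4
  Γpr-attained = D , ((dom , m , by-coordinates (λ x → x ∈ₛ D → m x ∈ₛ D × E G x (m x) × m (m x) ≡ x) matched) , minimal)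
    , trans (∣fromList∣ (block-unique (from-yes (unique? (0F ∷ 1F ∷ []))) (from-yes (unique? (0F ∷ 1F ∷ 2F ∷ 3F ∷ []))))) length-block
    where
    -- Both ends of each K₂ and, in each C₅, the path on four vertices that omits `4F`.
    open Block (0F ∷ 1F ∷ []) (0F ∷ 1F ∷ 2F ∷ 3F ∷ [])
    D : Subset n
    D = fromList block
    unique? : ∀ {k} (xs : List (Fin k)) → Dec (Unique xs)
    unique? = AllPairs.allPairs? (λ x y → ¬? (x Fin.≟ y))
    ∈D : ∀ x → Selected x → vertex x ∈ₛ D
    ∈D x sel = ∈-subset⁺ (_∈? block) (∈-block⁺ x sel)
    selected : ∀ x → vertex x ∈ₛ D → Selected x
    selected x x∈ = block⇒selected x (∈-subset⁻ (_∈? block) x∈)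
    any₂ : (p : Fin 2) → p ∈ 0F ∷ 1F ∷ []
    any₂ = ∈-allFin
    ≢4⇒selected : ∀ {p} → p ≢ 4F → p ∈ 0F ∷ 1F ∷ 2F ∷ 3F ∷ []
    ≢4⇒selected {0F} _ = here refl
    ≢4⇒selected {1F} _ = there (here refl)
    ≢4⇒selected {2F} _ = there (there (here refl))
    ≢4⇒selected {3F} _ = there (there (there (here refl)))
    ≢4⇒selected {4F} ne = ⊥-elim (ne refl)
    4∉ : ∀ {p} → p ∈ 0F ∷ 1F ∷ 2F ∷ 3F ∷ [] → p ≢ 4F
    4∉ p∈ refl with p∈
    ... | there (there (there (there ())))
    dom : Dominating G D
    dom = by-coordinates (λ x → x ∈ₛ D ⊎ ∃ λ z → z ∈ₛ D × E G z x) λ where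
      (inj₁ (c , p)) → inj₁ (∈D (inj₁ (c , p)) (any₂ p))
      (inj₂ (c , 4F)) → inj₂ (_ , ∈D (inj₂ (c , 0F)) (here refl) , pred-edge)
      (inj₂ (c , 0F)) → inj₁ (∈D (inj₂ (c , 0F)) (≢4⇒selected λ ()))
      (inj₂ (c , 1F)) → inj₁ (∈D (inj₂ (c , 1F)) (≢4⇒selected λ ()))
      (inj₂ (c , 2F)) → inj₁ (∈D (inj₂ (c , 2F)) (≢4⇒selected λ ()))
      (inj₂ (c , 3F)) → inj₁ (∈D (inj₂ (c , 3F)) (≢4⇒selected λ ()))
    -- The value at 4F is irrelevant: it is not selected.
    partner : Coord m₁ m₂ → Coord m₁ m₂
    partner (inj₁ (c , p)) = inj₁ (c , flip₂ p)
    partner (inj₂ (c , 0F)) = inj₂ (c , 1F)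
    partner (inj₂ (c , 1F)) = inj₂ (c , 0F)
    partner (inj₂ (c , 2F)) = inj₂ (c , 3F)
    partner (inj₂ (c , 3F)) = inj₂ (c , 2F)
    partner (inj₂ (c , 4F)) = inj₂ (c , 4F)
    m : Fin n → Fin n
    m x = vertex (partner (coordinate x))
    partner-matched : ∀ x → Selected x → Selected (partner x) × partner x ∈ neighbours x × partner (partner x) ≡ x
    partner-matched (inj₁ (c , 0F)) _ = there (here refl) , here refl , refl
    partner-matched (inj₁ (c , 1F)) _ = here refl , here refl , refl
    partner-matched (inj₂ (c , 0F)) _ = there (here refl) , here refl , refl
    partner-matched (inj₂ (c , 1F)) _ = here refl , there (here refl) , refl
    partner-matched (inj₂ (c , 2F)) _ = there (there (there (here refl))) , here refl , refl
    partner-matched (inj₂ (c , 3F)) _ = there (there (here refl)) , there (here refl) , refl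
    partner-matched (inj₂ (c , 4F)) sel = ⊥-elim (4∉ sel refl)
    matched : ∀ x → vertex x ∈ₛ D → m (vertex x) ∈ₛ D × E G (vertex x) (m (vertex x)) × m (m (vertex x)) ≡ vertex x
    matched x x∈ rewrite coordinate-vertex x | coordinate-vertex (partner x) =
      let sel , near , inv = partner-matched x (selected x x∈) in ∈D (partner x) sel , adjacent x near , cong vertex inv
    -- A paired dominating subset still omits every `4F`, so `first-four` returns the whole path. In
    -- a K₂ it contains an end by domination and then the other by matching.
    minimal : ∀ D′ → D′ ⊂ₛ D → ¬ PairedDominating G D′
    minimal D′ (sub , x , x∈ , x∉) (dom′ , matching) with ∈-block⁻ (∈-subset⁻ (_∈? block) x∈)
    ... | y , sel , refl = x∉ (full y sel)
      where
      open Matched matching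
      full : ∀ y → Selected y → vertex y ∈ₛ D′
      full (inj₂ (c , p)) sel = first-four c dom′ (λ 4∈ → 4∉ (selected (inj₂ (c , 4F)) (sub 4∈)) refl) p (4∉ sel)
      full (inj₁ (c , p)) _ with dom′ (vertex (inj₁ (c , p)))
      ... | inj₁ p∈ = p∈
      ... | inj₂ (z , z∈ , e) with neighbour₁ (E-sym e)
      full (inj₁ (c , 0F)) _ | inj₂ (_ , z∈ , e) | refl = matched₁ z∈
      full (inj₁ (c , 1F)) _ | inj₂ (_ , z∈ , e) | refl = matched₁ z∈

  equality : Σ ℕ λ k → UpperDomination G k × UpperPairedDomination G (2 * k)
  equality = m₁ * 1 + m₂ * 2 , (Γ-attained , Γ≤) , subst (UpperPairedDomination G) double (Γpr-attained , Γpr≤)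
    where
    open +-*-Solver
    double : m₁ * 2 + m₂ * 4 ≡ 2 * (m₁ * 1 + m₂ * 2)
    double = solve 2 (λ a b → a :* con 2 :+ b :* con 4 := con 2 :* (a :* con 1 :+ b :* con 2)) refl m₁ m₂

-- From the equality to the isomorphism and back

decomposition-nonempty : ∀ {n} {G : Graph n} {m₁ m₂} → 0 < n → Decomposition G m₁ m₂ → 1 ≤ m₁ + m₂
decomposition-nonempty {m₁ = suc _} _ _ = s≤s z≤n
decomposition-nonempty {m₁ = zero} {suc _} _ _ = s≤s z≤n
decomposition-nonempty {m₁ = zero} {zero} (s≤s _) d with Decomposition.coordinate d zero
... | inj₁ (() , _)
... | inj₂ (() , _)

equality⇒decomposition : ∀ {n} (G : Graph n) → Cactus G → TriangleFree G →
  ∀ {k} → UpperDomination G k → UpperPairedDomination G (2 * k) → ∃₂ λ m₁ m₂ → Decomposition G m₁ m₂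
equality⇒decomposition G cactus △-free {k} (_ , Γ≤k) ((D , minPaired , ∣D∣≡2k) , _) =
  _ , _ , PentagonDecomposition.decomposition G cactus △-free corona Γ≤j
  where
  open MinimalPaired G minPaired
  -- The equality Γpr(G) = 2Γ(G) enters here: there are at least Γ(G) pairs, so their number bounds
  -- all minimal dominating sets.
  k≤j : k ≤ length reps
  k≤j = ℕ.*-cancelˡ-≤ 2 (subst (_≤ 2 * length reps) ∣D∣≡2k ∣D∣≤)
  Γ≤j : ∀ S → MinimalDominating G S → ∣ S ∣ ≤ length reps
  Γ≤j S minDom = ℕ.≤-trans (Γ≤k S minDom) k≤j
  corona : Corona G (length reps)
  corona = EveryPairHasLeaf.corona G cactus △-free pairs (Domination.independent-bound G Γ≤j)

theorem20 : ∀ {n} (G : Graph n) → 0 < n → Cactus G → TriangleFree G →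
    ((Σ ℕ λ k → UpperDomination G k × UpperPairedDomination G (2 * k))
    ⇔ (Σ ℕ λ m₁ → Σ ℕ λ m₂ → (1 ≤ m₁ + m₂) × Isomorphic G (K2C5adj m₁ m₂)))
theorem20 G n>0 cactus △-free = mk⇔
  (λ (k , Γ , Γpr) →
    let m₁ , m₂ , d = equality⇒decomposition G cactus △-free Γ Γpr
    in m₁ , m₂ , decomposition-nonempty n>0 d , decomposition⇒isomorphic G d)
  (λ (m₁ , m₂ , _ , iso) → DecomposedGraph.equality (isomorphic⇒decomposition G {m₁} {m₂} iso))
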